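{- For every integer $k \ge 3$ and every integer $q \ge 1$ there is a constant $C_{k,q}$ such that for every positive integer $m$ and every $k$-uniform hypergraph $H$ with $m$ edges and no isolated vertices, the $q$-color Ramsey number of $H$ satisfies \[ r_k(H;q) \le \mathrm{tw}_k\left(C_{k,q}\sqrt{m}\right). \]
   Context: For a $k$-uniform hypergraph $H$ and a positive integer $q$, the $q$-color Ramsey number $r_k(H;q)$ is the minimum integer $N$ such that every coloring of the edges of the complete $k$-uniform hypergraph $K_N^{(k)}$ on $N$ vertices with $q$ colors contains a monochromatic copy of $H$ (as a not necessarily induced subhypergraph). The tower function is defined for real $x$ by $\mathrm{tw}_1(x)=x$ and $\mathrm{tw}_k(x)=2^{\mathrm{tw}_{k-1}(x)}$ for $k\ge 2$. A vertex is isolated if it lies in no edge. -}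

module Defs where

open import Data.Nat.Base as ℕ using (ℕ; zero; suc)
import Data.Nat.Properties as ℕ
open import Data.Integer.Base as ℤ using (+_)
import Data.Integer.Properties as ℤ
import Data.Rational.Unnormalised.Base as ℚᵘ
import Data.Rational.Unnormalised.Properties as ℚᵘ
open import Data.Rational.Base
open import Data.Rational.Properties
open import Data.Fin.Base using (Fin)
open import Data.Fin.Subset using (Subset; _∈_) renaming (∣_∣ to card)
open import Data.List.Base using (List; length)
open import Data.List.Relation.Unary.All using (All)
open import Data.List.Relation.Unary.Unique.Propositional using (Unique)
import Data.List.Membership.Propositional as List
open import Data.Product.Base using (Σ; ∃; ∃₂; _×_; _,_; proj₁)
open import Data.Sum.Base using (inj₁; inj₂)
open import Function.Bundles using (_⇔_)
open import Function.Definitions using (Injective)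
open import Algebra.Bundles using (CommutativeRing)
open import Algebra.Properties.Semiring.Exp
  (CommutativeRing.semiring +-*-commutativeRing) using (_^_; ^-assocʳ)
open import Relation.Binary.Definitions using (tri<; tri≈; tri>)
open import Relation.Binary.PropositionalEquality
  using (_≡_; refl; sym; trans; cong; subst)
open import Relation.Nullary.Negation using (contradiction)

-- A positive real x is represented by its lower Dedekind cut: x ∋ p means p < x.
-- Locatedness is not required; classically it is automatic.

record ℝ⁺ : Set₁ where
  infix 4 _∋_
  field
    _∋_      : ℚ → Set
    ∋0       : _∋_ 0ℚ
    bounded  : ∃ λ u → ∀ {p} → _∋_ p → p < u
    lower    : ∀ {p q} → p ≤ q → _∋_ q → _∋_ p
    rounded  : ∀ {p} → _∋_ p → ∃ λ q → p < q × _∋_ q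

open ℝ⁺ public using (_∋_)

fromℕ : ℕ → ℚ
fromℕ n = + n / 1

-- The order of ℝ restricted to n on the left: the cut of n lies inside that of x.
infix 4 _≤ℝ_
_≤ℝ_ : ℕ → ℝ⁺ → Set
n ≤ℝ x = ∀ p → p < fromℕ n → x ∋ p

2ℚ : ℚ
2ℚ = fromℕ 2

module PowerLemmas where

  *-mono-≤₀ : ∀ {p p′ q q′} → 0ℚ ≤ p → p ≤ p′ → 0ℚ ≤ q → q ≤ q′ →
              p * q ≤ p′ * q′
  *-mono-≤₀ {p} {p′} {q} {q′} 0≤p p≤p′ 0≤q q≤q′ = ≤-trans
    (*-monoʳ-≤-nonNeg q {{nonNegative 0≤q}} p≤p′)
    (*-monoˡ-≤-nonNeg p′ {{nonNegative (≤-trans 0≤p p≤p′)}} q≤q′)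

  *-mono-<₀ : ∀ {p p′ q q′} → 0ℚ < p → p < p′ → 0ℚ < q → q < q′ →
              p * q < p′ * q′
  *-mono-<₀ {p} {p′} {q} {q′} 0<p p<p′ 0<q q<q′ = <-trans
    (*-monoˡ-<-pos q {{positive 0<q}} p<p′)
    (*-monoʳ-<-pos p′ {{positive (<-trans 0<p p<p′)}} q<q′)

  *-nonneg : ∀ {p q} → 0ℚ ≤ p → 0ℚ ≤ q → 0ℚ ≤ p * q
  *-nonneg {p} {q} 0≤p 0≤q =
    subst (_≤ p * q) (*-zeroˡ 0ℚ) (*-mono-≤₀ ≤-refl 0≤p ≤-refl 0≤q)

  0≤1 : 0ℚ ≤ 1ℚ
  0≤1 = *≤* (ℤ.+≤+ ℕ.z≤n)

  0<1 : 0ℚ < 1ℚ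
  0<1 = *<* (ℤ.+<+ (ℕ.s≤s ℕ.z≤n))

  ^-nonneg : ∀ {p} n → 0ℚ ≤ p → 0ℚ ≤ p ^ n
  ^-nonneg zero    0≤p = 0≤1
  ^-nonneg (suc n) 0≤p = *-nonneg 0≤p (^-nonneg n 0≤p)

  ^-mono-≤ : ∀ {p q} n → 0ℚ ≤ p → p ≤ q → p ^ n ≤ q ^ n
  ^-mono-≤ zero    0≤p p≤q = ≤-refl
  ^-mono-≤ (suc n) 0≤p p≤q =
    *-mono-≤₀ 0≤p p≤q (^-nonneg n 0≤p) (^-mono-≤ n 0≤p p≤q)

  1≤^ : ∀ {p} n → 1ℚ ≤ p → 1ℚ ≤ p ^ n
  1≤^ zero    1≤p = ≤-refl
  1≤^ {p} (suc n) 1≤p = *-mono-≤₀ 0≤1 1≤p 0≤1 (1≤^ n 1≤p)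

  ≤^suc : ∀ {p} n → 1ℚ ≤ p → p ≤ p ^ suc n
  ≤^suc {p} n 1≤p = subst (_≤ p ^ suc n) (*-identityʳ p)
    (*-mono-≤₀ (≤-trans 0≤1 1≤p) ≤-refl 0≤1 (1≤^ n 1≤p))

  ^-monoʳ-≤ : ∀ {p m n} → 1ℚ ≤ p → m ℕ.≤ n → p ^ m ≤ p ^ n
  ^-monoʳ-≤ {n = n} 1≤p ℕ.z≤n = 1≤^ n 1≤p
  ^-monoʳ-≤ {m = suc m} 1≤p (ℕ.s≤s m≤n) = *-mono-≤₀
    (≤-trans 0≤1 1≤p) ≤-refl (^-nonneg m (≤-trans 0≤1 1≤p)) (^-monoʳ-≤ 1≤p m≤n)

  p<p+1 : ∀ p → p < p + 1ℚ
  p<p+1 p = subst (_< p + 1ℚ) (+-identityʳ p) (+-monoʳ-< p 0<1)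

  *-roundedˡ : ∀ {p y t} → 0ℚ ≤ y → p * y < t → ∃ λ p′ → p < p′ × p′ * y < t
  *-roundedˡ {p} {y} {t} 0≤y py<t with <-cmp 0ℚ y
  ... | tri> _ _ y<0 = contradiction (<-≤-trans y<0 0≤y) (<-irrefl refl)
  ... | tri≈ _ refl _ = p + 1ℚ , p<p+1 p ,
        subst (_< t) (trans (*-zeroʳ p) (sym (*-zeroʳ (p + 1ℚ)))) py<t
  ... | tri< 0<y _ _ = bound (<-dense p<t/y)
    where
      instance
        y⁺ : Positive y
        y⁺ = positive 0<y
        y≢0 : NonZero y
        y≢0 = pos⇒nonZero y
      t/y*y : t * 1/ y * y ≡ t
      t/y*y = trans (*-assoc t (1/ y) y)
        (trans (cong (t *_) (*-inverseˡ y)) (*-identityʳ t))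
      p<t/y : p < t * 1/ y
      p<t/y = *-cancelʳ-<-nonNeg y {{pos⇒nonNeg y}}
        (subst (p * y <_) (sym t/y*y) py<t)
      bound : (∃ λ p′ → p < p′ × p′ < t * 1/ y) → ∃ λ p′ → p < p′ × p′ * y < t
      bound (p′ , p<p′ , p′<) =
        p′ , p<p′ , subst (p′ * y <_) t/y*y (*-monoˡ-<-pos y p′<)

  *-rounded : ∀ {p y t} → 0ℚ ≤ p → 0ℚ ≤ y → p * y < t →
              ∃₂ λ p′ y′ → p < p′ × y < y′ × p′ * y′ < t
  *-rounded {p} {y} {t} 0≤p 0≤y py<t =
    let p′ , p<p′ , p′y<t = *-roundedˡ 0≤y py<t
        y′ , y<y′ , y′p′<t = *-roundedˡ (≤-trans 0≤p (<⇒≤ p<p′))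
                               (subst (_< t) (*-comm p′ y) p′y<t)
    in p′ , y′ , p<p′ , y<y′ , subst (_< t) (*-comm y′ p′) y′p′<t

  ^-rounded : ∀ {p t} n → 0ℚ ≤ p → p ^ n < t → ∃ λ q → p < q × q ^ n < t
  ^-rounded {p} zero 0≤p 1<t = p + 1ℚ , p<p+1 p , 1<t
  ^-rounded {p} {t} (suc n) 0≤p pⁿ<t
    with *-rounded 0≤p (^-nonneg n 0≤p) pⁿ<t
  ... | p₁ , y , p<p₁ , pⁿ<y , p₁y<t with ^-rounded n 0≤p pⁿ<y
  ... | p₂ , p<p₂ , p₂ⁿ<y with ≤-total p₁ p₂
  ... | inj₁ p₁≤p₂ = p₁ , p<p₁ , ≤-<-trans
          (*-mono-≤₀ 0≤p₁ ≤-refl (^-nonneg n 0≤p₁)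
            (≤-trans (^-mono-≤ n 0≤p₁ p₁≤p₂) (<⇒≤ p₂ⁿ<y)))
          p₁y<t
    where 0≤p₁ = ≤-trans 0≤p (<⇒≤ p<p₁)
  ... | inj₂ p₂≤p₁ = p₂ , p<p₂ , ≤-<-trans
          (*-mono-≤₀ 0≤p₂ p₂≤p₁ (^-nonneg n 0≤p₂) (<⇒≤ p₂ⁿ<y))
          p₁y<t
    where 0≤p₂ = ≤-trans 0≤p (<⇒≤ p<p₂)

open PowerLemmas

-- The lower cut of the n-th root of t: all p with p < 0 or pⁿ < t.
BelowRoot : ℕ → ℚ → ℚ → Set
BelowRoot n t p = (p ⊔ 0ℚ) ^ n < t

module RootLemmas where

  root-lower : ∀ {p q t} n → p ≤ q → BelowRoot n t q → BelowRoot n t p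
  root-lower {p} n p≤q = ≤-<-trans
    (^-mono-≤ n (p≤q⊔p p 0ℚ) (⊔-monoˡ-≤ 0ℚ p≤q))

  root-rounded : ∀ {p t} n → BelowRoot n t p →
                 ∃ λ q → p < q × BelowRoot n t q
  root-rounded {p} {t} n pⁿ<t with ^-rounded n (p≤q⊔p p 0ℚ) pⁿ<t
  ... | q , p⊔0<q , qⁿ<t =
        q , ≤-<-trans (p≤p⊔q p 0ℚ) p⊔0<q ,
        subst (λ r → r ^ n < t)
          (sym (p≥q⇒p⊔q≡p (≤-trans (p≤q⊔p p 0ℚ) (<⇒≤ p⊔0<q)))) qⁿ<t

  root-bounded : ∀ {p t u} n → 0ℚ ≤ u → t ≤ u ^ n → BelowRoot n t p → p < u
  root-bounded {p} {t} {u} n 0≤u t≤uⁿ pⁿ<t = ≰⇒> λ u≤p →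
    <-irrefl refl (<-≤-trans pⁿ<t (≤-trans t≤uⁿ
      (^-mono-≤ n 0≤u (≤-trans u≤p (p≤p⊔q p 0ℚ)))))

  toℚᵘ-fromℕ : ∀ n → toℚᵘ (fromℕ n) ℚᵘ.≃ ℚᵘ.mkℚᵘ (+ n) 0
  toℚᵘ-fromℕ n = toℚᵘ-fromℚᵘ (ℚᵘ.mkℚᵘ (+ n) 0)

  /<fromℕ : ∀ a b n → + a / suc b < fromℕ n → a ℕ.< n ℕ.* suc b
  /<fromℕ a b n a/b<n with
    ℚᵘ.<-respˡ-≃ (toℚᵘ-fromℚᵘ (ℚᵘ.mkℚᵘ (+ a) b))
      (ℚᵘ.<-respʳ-≃ (toℚᵘ-fromℕ n) (toℚᵘ-mono-< a/b<n))
  ... | ℚᵘ.*<* lt = ℤ.drop‿+<+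
        (subst (ℤ._< _) (ℤ.*-identityʳ (+ a))
          (subst (_ ℤ.<_) (sym (ℤ.pos-* n (suc b))) lt))

  fromℕ-mono-≤ : ∀ {m n} → m ℕ.≤ n → fromℕ m ≤ fromℕ n
  fromℕ-mono-≤ {m} {n} m≤n = toℚᵘ-cancel-≤
    (ℚᵘ.≤-respˡ-≃ (ℚᵘ.≃-sym (toℚᵘ-fromℕ m))
      (ℚᵘ.≤-respʳ-≃ (ℚᵘ.≃-sym (toℚᵘ-fromℕ n))
        (ℚᵘ.*≤* (ℤ.*-monoʳ-≤-nonNeg (+ 1) (ℤ.+≤+ m≤n)))))

  ≤fromℕ : ∀ p → ∃ λ n → p ≤ fromℕ n
  ≤fromℕ p@(mkℚ i d _) = ℤ.∣ i ∣ , toℚᵘ-cancel-≤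
    (ℚᵘ.≤-respʳ-≃ (ℚᵘ.≃-sym (toℚᵘ-fromℕ ℤ.∣ i ∣))
      (ℚᵘ.*≤* (ℤ.≤-trans (ℤ.≤-reflexive (ℤ.*-identityʳ i))
        (ℤ.≤-trans (i≤∣i∣ i)
          (subst (+ ℤ.∣ i ∣ ℤ.≤_) (ℤ.pos-* ℤ.∣ i ∣ (suc d))
            (ℤ.+≤+ (ℕ.m≤m*n ℤ.∣ i ∣ (suc d))))))))
    where
      i≤∣i∣ : ∀ i → i ℤ.≤ + ℤ.∣ i ∣
      i≤∣i∣ (+ n)       = ℤ.≤-refl
      i≤∣i∣ (ℤ.-[1+ n ]) = ℤ.-≤+

open RootLemmas

√ : (m : ℕ) .{{_ : ℕ.NonZero m}} → ℝ⁺
√ m = record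
  { _∋_      = BelowRoot 2 (fromℕ m)
  ; ∋0       = <-≤-trans 0<1 1≤m
  ; bounded  = fromℕ m , root-bounded 2 (≤-trans 0≤1 1≤m) (≤^suc 1 1≤m)
  ; lower    = root-lower 2
  ; rounded  = root-rounded 2
  }
  where
    1≤m : 1ℚ ≤ fromℕ m
    1≤m = fromℕ-mono-≤ (ℕ.>-nonZero⁻¹ m)

infixl 7 _·_
_·_ : ℝ⁺ → ℝ⁺ → ℝ⁺
x · y = record
  { _∋_      = λ p → ∃₂ λ r s → 0ℚ < r × x ∋ r × 0ℚ < s × y ∋ s × p ≤ r * s
  ; ∋0       =
      let r , 0<r , r∈ = ℝ⁺.rounded x (ℝ⁺.∋0 x)
          s , 0<s , s∈ = ℝ⁺.rounded y (ℝ⁺.∋0 y)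
      in r , s , 0<r , r∈ , 0<s , s∈ , *-nonneg (<⇒≤ 0<r) (<⇒≤ 0<s)
  ; bounded  =
      let u , <u = ℝ⁺.bounded x
          v , <v = ℝ⁺.bounded y
      in u * v , λ { (r , s , 0<r , r∈ , 0<s , s∈ , p≤rs) →
           ≤-<-trans p≤rs (*-mono-<₀ 0<r (<u r∈) 0<s (<v s∈)) }
  ; lower    = λ { p≤q (r , s , 0<r , r∈ , 0<s , s∈ , q≤rs) →
      r , s , 0<r , r∈ , 0<s , s∈ , ≤-trans p≤q q≤rs }
  ; rounded  = λ { (r , s , 0<r , r∈ , 0<s , s∈ , p≤rs) →
      let r′ , r<r′ , r′∈ = ℝ⁺.rounded x r∈
          s′ , s<s′ , s′∈ = ℝ⁺.rounded y s∈
      in r′ * s′ , ≤-<-trans p≤rs (*-mono-<₀ 0<r r<r′ 0<s s<s′) ,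
         r′ , s′ , <-trans 0<r r<r′ , r′∈ , <-trans 0<s s<s′ , s′∈ , ≤-refl }
  }

-- 2ˣ is the supremum of 2^(a/b), the b-th root of 2ᵃ, over the fractions
-- 0 ≤ a/b < x.  (The denominator is written suc b.)
exp₂ : ℝ⁺ → ℝ⁺
exp₂ x = record
  { _∋_      = λ p → ∃₂ λ a b → x ∋ (+ a / suc b) × BelowRoot (suc b) (2ℚ ^ a) p
  ; ∋0       = 0 , 0 , ℝ⁺.∋0 x , 0<1
  ; bounded  =
      let u , <u = ℝ⁺.bounded x
          n , u≤n = ≤fromℕ u
      in 2ℚ ^ n , λ { (a , b , a/b∈ , p∈) →
           root-bounded (suc b) (^-nonneg n (≤-trans 0≤1 1≤2))
             (subst (2ℚ ^ a ≤_) (sym (^-assocʳ 2ℚ n (suc b)))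
               (^-monoʳ-≤ 1≤2
                 (ℕ.<⇒≤ (/<fromℕ a b n (<-≤-trans (<u a/b∈) u≤n)))))
             p∈ }
  ; lower    = λ { p≤q (a , b , a/b∈ , q∈) →
      a , b , a/b∈ , root-lower (suc b) p≤q q∈ }
  ; rounded  = λ { (a , b , a/b∈ , p∈) →
      let q , p<q , q∈ = root-rounded (suc b) p∈ in q , p<q , a , b , a/b∈ , q∈ }
  }
  where
    1≤2 : 1ℚ ≤ 2ℚ
    1≤2 = fromℕ-mono-≤ {1} {2} (ℕ.s≤s ℕ.z≤n)

-- The tower function is defined from height 1 on; the value at 0 is a dummy.
tw : ℕ → ℝ⁺ → ℝ⁺
tw zero          x = x
tw (suc zero)    x = x
tw (suc (suc k)) x = exp₂ (tw (suc k) x)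

record Hypergraph (k : ℕ) : Set where
  field
    order    : ℕ
    edges    : List (Subset order)
    distinct : Unique edges
    uniform  : All (λ e → card e ≡ k) edges

  size : ℕ
  size = length edges

  NoIsolatedVertices : Set
  NoIsolatedVertices = ∀ (v : Fin order) → ∃ λ e → e List.∈ edges × v ∈ e

open Hypergraph public using (size; NoIsolatedVertices)

KEdge : ℕ → ℕ → Set
KEdge k N = Σ (Subset N) λ e → card e ≡ k

Colouring : ℕ → ℕ → ℕ → Set
Colouring k N q = KEdge k N → Fin q

IsImage : ∀ {n N} → (Fin n → Fin N) → Subset n → Subset N → Set
IsImage f e e′ = ∀ w → w ∈ e′ ⇔ (∃ λ v → v ∈ e × f v ≡ w)

MonochromaticCopy : ∀ {k N q} → Hypergraph k → Colouring k N q → Set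
MonochromaticCopy {k} {N} {q} H χ =
  ∃₂ λ (f : Fin order → Fin N) (c : Fin q) → Injective _≡_ _≡_ f ×
    (∀ e → e List.∈ edges →
      ∃ λ (e′ : KEdge k N) → IsImage f e (proj₁ e′) × χ e′ ≡ c)
  where open Hypergraph H

Arrows : ∀ {k} → Hypergraph k → ℕ → ℕ → Set
Arrows {k} H q N = (χ : Colouring k N q) → MonochromaticCopy H χ

IsRamseyNumber : ∀ {k} → Hypergraph k → ℕ → ℕ → Set
IsRamseyNumber H q r = Arrows H q r × (∀ N → Arrows H q N → r ℕ.≤ N)

{-# OPTIONS --safe #-}

-- The chromatic number of the shadow of H is O(√m), so H embeds in a blow-up of a complete
-- hypergraph on K = O(√m) vertices, and only the sizes c_j of the parts are delicate.
-- Removing vertices of minimum degree shows that there is a strong colouring whose j-th class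
-- has at most K²/(j+1)² + 1 vertices, and then ∏ (c_j + 2) ≤ (3K²)^K / (K!)² = 2^O(K).
--
-- Let R be the Ramsey number of the complete hypergraph on K vertices; the Erdős–Rado argument
-- gives R ≤ tw_k(O(K)).  Take R disjoint parts.  Every transversal contains a monochromatic
-- K-set, so by averaging some K parts and one colour serve a proportion 1/D of all transversals,
-- where D = O(R^K).  The Kővári–Sós–Turán–Erdős argument picks subsets of the parts one part at a
-- time: fixing c_j + 1 vertices changes the density 1/D into 1/D^(3(c_j+2)).  Hence parts of size
-- D^∏3(c_j+2) = R^2^O(K) suffice.  For k ≥ 3 the factor 2^O(K) is absorbed by log R.

module Submission where

open import Defs
open import Data.Nat.Base
  using (ℕ; zero; suc; _+_; _*_; _^_; _!; _≤_; _<_; _≤ᵇ_; z≤n; s≤s;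
         NonZero; >-nonZero; >-nonZero⁻¹)
open import Data.Nat.Properties
open import Data.Nat.DivMod using (_/_; _%_; m≡m%n+[m/n]*n; m%n<n; m/n*n≤m; /-monoʳ-≤)
open import Data.Nat.ListAction using (sum)
open import Data.Nat.ListAction.Properties using (sum-++; sum-↭)
open import Data.Nat.Tactic.RingSolver using (solve-∀)
import Data.Integer.Base as ℤ
import Data.Integer.Properties as ℤ
open import Data.Rational.Base as ℚ using (ℚ; mkℚ; 0ℚ; toℚᵘ)
import Data.Rational.Properties as ℚ
open import Data.Rational.Unnormalised.Base as ℚᵘ using (mkℚᵘ)
import Data.Rational.Unnormalised.Properties as ℚᵘ
open import Algebra.Bundles using (CommutativeRing)
open import Algebra.Properties.Semiring.Exp
  (CommutativeRing.semiring ℚ.+-*-commutativeRing) using () renaming (_^_ to _^ℚ_)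
open import Algebra.Properties.CommutativeSemigroup +-commutativeSemigroup
  using () renaming (interchange to +-interchange)
open import Data.Bool.Base using (Bool; true; false; T; _∧_; not; _∨_; if_then_else_)
open import Data.Bool.Properties using (T-≡; T-∧; T?; ∧-comm)
open import Data.Bool.ListAction using (all; any)
open import Data.Fin.Base using (Fin; zero; suc; toℕ; fromℕ<; combine; finToFun; funToFin)
open import Data.Fin.Properties using (any?; all?; toℕ<n; toℕ-fromℕ<; combine-injective; finToFun-funToFin)
  renaming (_≟_ to _≟ᶠ_; suc-injective to sucᶠ-injective)
open import Data.Fin.Subset using (Subset) renaming (_∈_ to _∈ˢ_; ∣_∣ to card)
open import Data.Fin.Subset.Properties using (anySubset?; ⊆-antisym) renaming (_∈?_ to _∈ˢ?_)
open import Data.List.Base as List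
  using (List; []; _∷_; _++_; map; length; filter; take; reverse; _ʳ++_; tabulate; allFin; upTo;
         cartesianProduct; cartesianProductWith)
open import Data.List.Properties
  using (map-++; map-∘; map-cong; map-tabulate; filter-none; length-map; length-++; length-tabulate;
         length-reverse; length-take; length-upTo)
open import Data.List.Membership.Propositional using (_∈_; lose; find)
open import Data.List.Membership.Propositional.Properties
  using (∈-∃++; ∈-map⁺; ∈-map⁻; ∈-++⁺ˡ; ∈-++⁺ʳ; ∈-++⁻; ∈-allFin; ∈-filter⁺; ∈-filter⁻; ∈-upTo⁻;
         ∈-tabulate⁺; ∈-lookup; ∈-cartesianProduct⁺; ∈-cartesianProduct⁻)
import Data.List.Membership.DecPropositional as DecMembership
open import Data.List.Relation.Unary.Any as Any using (Any; here; there)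
open import Data.List.Relation.Unary.Any.Properties using (any⁺)
open import Data.List.Relation.Unary.All as All using (All; []; _∷_)
open import Data.List.Relation.Unary.All.Properties using (++⁻ˡ; all⁺; all⁻)
open import Data.List.Relation.Unary.AllPairs using ([]; _∷_)
open import Data.List.Relation.Unary.Unique.Propositional using (Unique)
import Data.List.Relation.Unary.Unique.Propositional.Properties as Unique
open import Data.List.Relation.Binary.Sublist.Propositional
  using (_⊆_; []; _∷_; _∷ʳ_; ⊆-refl; ⊆-trans; minimum) renaming (lookup to ⊆-lookup)
open import Data.List.Relation.Binary.Sublist.Propositional.Properties
  using (filter-⊆; take-⊆; reverse⁻; ʳ++⁺)
open import Data.List.Relation.Binary.Permutation.Propositional
  using (_↭_; ↭-refl; ↭-trans; prep; ↭⇒↭ₛ)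
open import Data.List.Relation.Binary.Permutation.Propositional.Properties
  using (map⁺; shift; ↭-length; ∈-resp-↭)
import Data.List.Relation.Binary.Permutation.Setoid.Properties as Permutation
open import Data.Vec.Base as Vec using (Vec; []; _∷_; lookup)
open import Data.Vec.Properties
  using ([]=⇒lookup; lookup⇒[]=; lookup∘tabulate; tabulate-cong; tabulate∘lookup)
open import Data.Product.Base using (∃; ∃₂; _×_; _,_; proj₁; proj₂)
open import Data.Product.Properties using (≡-dec)
open import Data.Sum.Base using (inj₁; inj₂)
open import Data.Empty using (⊥-elim)
open import Function.Base using (_∘_; id)
open import Function.Bundles using (mk⇔; Equivalence)
open import Function.Definitions using (Injective)
open import Relation.Binary.Definitions using (DecidableEquality)
open import Relation.Binary.PropositionalEquality
open import Relation.Nullary using (Dec; does; yes; no; ¬_)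
open import Relation.Nullary.Decidable using (map′; _×-dec_; _→-dec_; decidable-stable; dec-true)
open import Relation.Unary using (Decidable)
open RootLemmas using (toℚᵘ-fromℕ; fromℕ-mono-≤)

-- The `K` classes may have to hold up to `k * m` vertices. Equal class sizes would then be of order
-- √m, and ∏ (c_j + 2) would be 2^O(K log K), so that a logarithm would survive in the argument of
-- the tower. Sizes that fall like (K/(j+1))² avoid this, because the sum of log (K/(j+1)) over j <
-- K is O(K). Such a decay is possible because the degree sum of the shadow is at most D = m k². A
-- vertex whose degree a is least among t vertices satisfies a t ≤ D. It can do with the first 2a+1
-- classes, each of which has room for about K²/(2a+1)² vertices. The a+1 classes free of its
-- neighbours thus offer on the order of K²/a places, and 9D ≤ K² makes this exceed the number of
-- vertices already placed.

private variable
  A B C : Set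
  l n q R : ℕ

-- Sums and counting over lists

∑ : List A → (A → ℕ) → ℕ
∑ xs f = sum (map f xs)

ind : Bool → ℕ
ind true  = 1
ind false = 0

count : (A → Bool) → List A → ℕ
count P xs = ∑ xs (ind ∘ P)

∑-mono : ∀ (xs : List A) {f g} → (∀ x → x ∈ xs → f x ≤ g x) → ∑ xs f ≤ ∑ xs g
∑-mono []       f≤g = z≤n
∑-mono (x ∷ xs) f≤g = +-mono-≤ (f≤g x (here refl)) (∑-mono xs λ y → f≤g y ∘ there)

∑-cong : ∀ (xs : List A) {f g : A → ℕ} → (∀ x → f x ≡ g x) → ∑ xs f ≡ ∑ xs g
∑-cong xs f≡g = cong sum (map-cong f≡g xs)

∑-++ : ∀ (xs ys : List A) f → ∑ (xs ++ ys) f ≡ ∑ xs f + ∑ ys f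
∑-++ xs ys f = trans (cong sum (map-++ f xs ys)) (sum-++ (map f xs) (map f ys))

∑-map : ∀ (h : A → B) xs f → ∑ (map h xs) f ≡ ∑ xs (f ∘ h)
∑-map h xs f = cong sum (sym (map-∘ xs))

∑-↭ : ∀ {xs ys : List A} f → xs ↭ ys → ∑ xs f ≡ ∑ ys f
∑-↭ f p = sum-↭ (map⁺ f p)

∑-+ : ∀ (xs : List A) f g → ∑ xs (λ x → f x + g x) ≡ ∑ xs f + ∑ xs g
∑-+ []       f g = refl
∑-+ (x ∷ xs) f g = trans (cong (f x + g x +_) (∑-+ xs f g))
  (+-interchange (f x) (g x) (∑ xs f) (∑ xs g))

∑-*ˡ : ∀ (xs : List A) c f → ∑ xs (λ x → c * f x) ≡ c * ∑ xs f
∑-*ˡ []       c f = sym (*-zeroʳ c)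
∑-*ˡ (x ∷ xs) c f = trans (cong (c * f x +_) (∑-*ˡ xs c f))
  (sym (*-distribˡ-+ c (f x) (∑ xs f)))

∑-const : ∀ (xs : List A) c → ∑ xs (λ _ → c) ≡ length xs * c
∑-const []       c = refl
∑-const (x ∷ xs) c = cong (c +_) (∑-const xs c)

∑-swap : ∀ (xs : List A) (ys : List B) (f : A → B → ℕ) →
         ∑ xs (λ x → ∑ ys (f x)) ≡ ∑ ys (λ y → ∑ xs (λ x → f x y))
∑-swap []       ys f = sym (trans (∑-const ys 0) (*-zeroʳ (length ys)))
∑-swap (x ∷ xs) ys f = trans (cong (∑ ys (f x) +_) (∑-swap xs ys f))
  (sym (∑-+ ys (f x) (λ y → ∑ xs (λ x → f x y))))

∑-product : ∀ (h : A → B → C) xs ys f →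
            ∑ (cartesianProductWith h xs ys) f ≡ ∑ xs (λ x → ∑ ys (λ y → f (h x y)))
∑-product h []       ys f = refl
∑-product h (x ∷ xs) ys f = trans (∑-++ (map (h x) ys) _ f)
  (cong₂ _+_ (∑-map (h x) ys f) (∑-product h xs ys f))

length-product : ∀ (h : A → B → C) xs ys →
                 length (cartesianProductWith h xs ys) ≡ length xs * length ys
length-product h []       ys = refl
length-product h (x ∷ xs) ys = trans (length-++ (map (h x) ys))
  (cong₂ _+_ (length-map (h x) ys) (length-product h xs ys))

term≤∑ : ∀ {xs : List A} {x} f → x ∈ xs → f x ≤ ∑ xs f
term≤∑ f (here refl) = m≤m+n _ _
term≤∑ {xs = y ∷ ys} f (there x∈) = m≤n⇒m≤o+n (f y) (term≤∑ f x∈)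

∑-bounded : ∀ (xs : List A) f c → (∀ x → x ∈ xs → f x ≤ c) → ∑ xs f ≤ length xs * c
∑-bounded xs f c f≤c = subst (∑ xs f ≤_) (∑-const xs c) (∑-mono xs f≤c)

∑-bounded-below : ∀ (xs : List A) f c → (∀ x → x ∈ xs → c ≤ f x) → length xs * c ≤ ∑ xs f
∑-bounded-below xs f c c≤f = subst (_≤ ∑ xs f) (∑-const xs c) (∑-mono xs c≤f)

≤-average : ∀ (xs : List A) f a → 0 < length xs → length xs * a ≤ ∑ xs f →
            ∃ λ x → x ∈ xs × a ≤ f x
≤-average (x ∷ xs) f a _ la≤ with a ≤? f x
... | yes a≤ = x , here refl , a≤
... | no  a≰ with xs in eq
...   | [] = ⊥-elim (a≰ (+-cancelʳ-≤ 0 a (f x) la≤))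
...   | y ∷ ys with ≤-average xs f a (subst (λ zs → 0 < length zs) (sym eq) (s≤s z≤n))
                   (subst (λ zs → length zs * a ≤ ∑ zs f) (sym eq)
                     (+-cancelˡ-≤ a _ _ (≤-trans la≤ (+-monoˡ-≤ _ (<⇒≤ (≰⇒> a≰))))))
...     | z , z∈ , a≤ = z , there (subst (z ∈_) eq z∈) , a≤

≥-average : ∀ (xs : List A) f a → 0 < length xs → ∑ xs f ≤ length xs * a →
            ∃ λ x → x ∈ xs × f x ≤ a
≥-average (x ∷ xs) f a _ la≥ with f x ≤? a
... | yes a≥ = x , here refl , a≥
... | no  a≱ with xs in eq
...   | [] = ⊥-elim (a≱ (+-cancelʳ-≤ 0 (f x) a la≥))
...   | y ∷ ys with ≥-average xs f a (subst (λ zs → 0 < length zs) (sym eq) (s≤s z≤n))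
                   (subst (λ zs → ∑ zs f ≤ length zs * a) (sym eq)
                     (+-cancelˡ-≤ a _ _ (≤-trans (+-monoˡ-≤ _ (<⇒≤ (≰⇒> a≱))) la≥)))
...     | z , z∈ , a≥ = z , there (subst (z ∈_) eq z∈) , a≥

length-filter≡count : ∀ {P : A → Set} (P? : Decidable P) xs →
                      length (filter P? xs) ≡ count (does ∘ P?) xs
length-filter≡count P? []       = refl
length-filter≡count P? (x ∷ xs) with does (P? x)
... | true  = cong suc (length-filter≡count P? xs)
... | false = length-filter≡count P? xs

count-filter : ∀ {P : A → Set} (P? : Decidable P) Q xs →
               count Q (filter P? xs) ≡ count (λ x → does (P? x) ∧ Q x) xs
count-filter P? Q []       = refl
count-filter P? Q (x ∷ xs) with does (P? x)
... | true  = cong (ind (Q x) +_) (count-filter P? Q xs)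
... | false = count-filter P? Q xs

∈-↭∷ : ∀ {x : A} {xs} → x ∈ xs → ∃ λ ys → xs ↭ x ∷ ys
∈-↭∷ x∈xs with ∈-∃++ x∈xs
... | as , bs , refl = as ++ bs , shift _ as bs

ind≤1 : ∀ b → ind b ≤ 1
ind≤1 true  = ≤-refl
ind≤1 false = z≤n

length-allFin : ∀ n → length (allFin n) ≡ n
length-allFin n = length-tabulate {n = n} id

-- Ramsey's theorem for lists

combs : ℕ → List A → List (List A)
combs zero    xs       = [] ∷ []
combs (suc k) []       = []
combs (suc k) (x ∷ xs) = map (x ∷_) (combs k xs) ++ combs (suc k) xs

∈-combs⁺ : ∀ {xs ys : List A} → ys ⊆ xs → ys ∈ combs (length ys) xs
∈-combs⁺ []                = here refl
∈-combs⁺ {ys = []}     (x ∷ʳ τ) = here refl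
∈-combs⁺ {ys = y ∷ ys} (x ∷ʳ τ) = ∈-++⁺ʳ (map (x ∷_) (combs (length ys) _)) (∈-combs⁺ τ)
∈-combs⁺ (refl ∷ τ)        = ∈-++⁺ˡ (∈-map⁺ (_ ∷_) (∈-combs⁺ τ))

∈-combs⁻ : ∀ k (xs : List A) {ys} → ys ∈ combs k xs → ys ⊆ xs × length ys ≡ k
∈-combs⁻ zero    xs       (here refl) = minimum xs , refl
∈-combs⁻ (suc k) (x ∷ xs) ys∈ with ∈-++⁻ (map (x ∷_) (combs k xs)) ys∈
... | inj₂ ys∈′ = let τ , eq = ∈-combs⁻ (suc k) xs ys∈′ in x ∷ʳ τ , eq
... | inj₁ ys∈′ with ∈-map⁻ (x ∷_) ys∈′
...   | zs , zs∈ , refl = let τ , eq = ∈-combs⁻ k xs zs∈ in refl ∷ τ , cong suc eq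

length-combs : ∀ k (xs : List A) → length (combs k xs) ≤ length xs ^ k
length-combs zero    xs       = ≤-refl
length-combs (suc k) []       = z≤n
length-combs (suc k) (x ∷ xs) = begin
  length (map (x ∷_) (combs k xs) ++ combs (suc k) xs)
    ≡⟨ length-++ (map (x ∷_) (combs k xs)) ⟩
  length (map (x ∷_) (combs k xs)) + length (combs (suc k) xs)
    ≡⟨ cong (_+ _) (length-map (x ∷_) (combs k xs)) ⟩
  length (combs k xs) + length (combs (suc k) xs)
    ≤⟨ +-mono-≤ (length-combs k xs) (length-combs (suc k) xs) ⟩
  suc (length xs) * length xs ^ k
    ≤⟨ *-monoʳ-≤ (suc (length xs)) (^-monoˡ-≤ k (n≤1+n (length xs))) ⟩
  suc (length xs) ^ suc k ∎
  where open ≤-Reasoning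

pigeonhole : 0 < q → ∀ (g : A → Fin q) xs s → q * s ≤ length xs →
             ∃ λ c → s ≤ length (filter (λ x → g x ≟ᶠ c) xs)
pigeonhole {q = q} 0<q g xs s qs≤ =
  let c , _ , s≤ = ≤-average (allFin q) (λ c → count (is c) xs) s
        (subst (0 <_) (sym (length-allFin q)) 0<q) (begin
          length (allFin q) * s                 ≡⟨ cong (_* s) (length-allFin q) ⟩
          q * s                                 ≤⟨ qs≤ ⟩
          length xs                             ≡⟨ *-identityʳ _ ⟨
          length xs * 1                         ≤⟨ ∑-bounded-below xs _ 1 (λ x _ → one x) ⟩
          ∑ xs (λ x → ∑ (allFin q) (λ c → ind (is c x))) ≡⟨ ∑-swap xs (allFin q) _ ⟩
          ∑ (allFin q) (λ c → count (is c) xs)  ∎)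
  in c , subst (s ≤_) (sym (length-filter≡count (λ x → g x ≟ᶠ c) xs)) s≤
  where
    open ≤-Reasoning
    is : Fin q → _ → Bool
    is c x = does (g x ≟ᶠ c)
    one : ∀ x → 1 ≤ ∑ (allFin q) (λ c → ind (is c x))
    one x = subst (_≤ ∑ (allFin q) (λ c → ind (is c x)))
      (cong ind (dec-true (g x ≟ᶠ g x) refl))
      (term≤∑ (λ c → ind (is c x)) (∈-allFin (g x)))

-- Pigeonholing for one colouring after another costs a factor `q` each time, and passing to a
-- sublist keeps the earlier colourings constant.
refine : 0 < q → ∀ (gs : List (A → Fin q)) xs s → q ^ length gs * s ≤ length xs →
         ∃ λ ys → ys ⊆ xs × s ≤ length ys ×
           (∀ {g} → g ∈ gs → ∀ {w w′} → w ∈ ys → w′ ∈ ys → g w ≡ g w′)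
refine 0<q []       xs s s≤ = xs , ⊆-refl , subst (_≤ length xs) (*-identityˡ s) s≤ , λ ()
refine {q = q} 0<q (g ∷ gs) xs s qs≤ =
  let c , large = pigeonhole 0<q g xs (q ^ length gs * s)
                    (subst (_≤ length xs) (*-assoc q (q ^ length gs) s) qs≤)
      zs = filter (λ x → g x ≟ᶠ c) xs
      ys , ys⊆zs , s≤ , same = refine 0<q gs zs s large
      g≡c = λ {w} (w∈ : w ∈ ys) → proj₂ (∈-filter⁻ (λ x → g x ≟ᶠ c) {xs = xs} (⊆-lookup ys⊆zs w∈))
  in ys , ⊆-trans ys⊆zs (filter-⊆ _ xs) , s≤ , λ
       { (here refl) w∈ w′∈ → trans (g≡c w∈) (sym (g≡c w′∈))
       ; (there g∈)  w∈ w′∈ → same g∈ w∈ w′∈ }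

-- The base `suc q` in place of `q` gains at least one element per round, which pays for the
-- candidate that `pick` removes before it refines the rest.
q^e*s<1+q^e*s : ∀ q e s → 0 < e → 0 < s → suc (q ^ e * s) ≤ suc q ^ e * s
q^e*s<1+q^e*s q e s 0<e 0<s = *-monoˡ-< s {{>-nonZero 0<s}} (^-monoˡ-< e {{>-nonZero 0<e}} ≤-refl)

-- The picked list P has its most recent element in front; every candidate in S, and every
-- later pick, extends a j+1-element sublist of P with the same colour.
module ErdősRado (0<q : 0 < q) (j : ℕ) (χ : List A → Fin q) where

  Indifferent : List A → List A → Set
  Indifferent P S = ∀ {zs} → zs ⊆ P → length zs ≡ suc j →
    ∀ {w w′} → w ∈ S → w′ ∈ S → χ (w ∷ zs) ≡ χ (w′ ∷ zs)

  EndHomogeneous : List A → List A → Set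
  EndHomogeneous P S = ∀ {w zs} → (w ∷ zs) ⊆ P → length zs ≡ suc j →
    ∀ {w′} → w′ ∈ S → χ (w ∷ zs) ≡ χ (w′ ∷ zs)

  -- Each of the `i` remaining rounds moves the first candidate `y` to `P` and shrinks the others
  -- until, for every `j`-element sublist `zs` of the old `P`, the colour of `w ∷ y ∷ zs` no longer
  -- depends on the candidate `w`. There are at most `n ^ j` such `zs`, so a round costs at most a
  -- factor `suc q ^ (n ^ j)`.
  pick : ∀ n xs i P S → length P + i ≡ n → Indifferent P S → EndHomogeneous P S →
         P ʳ++ S ⊆ xs → suc q ^ (i * n ^ j) ≤ length S →
         ∃₂ λ P′ S′ → length P′ ≡ n × EndHomogeneous P′ S′ × P′ ʳ++ S′ ⊆ xs × 0 < length S′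
  pick n xs zero P S len ind end sub big =
    P , S , trans (sym (+-identityʳ (length P))) len , end , sub , big
  pick n xs (suc i) P [] len ind end sub big with () ← ≤-trans (m^n>0 (suc q) (suc i * n ^ j)) big
  pick n xs (suc i) P (y ∷ S) len ind end sub big =
    let S′ , S′⊆S , s≤ , same = refine 0<q gs S s enough
    in pick n xs i (y ∷ P) S′ (trans (sym (+-suc (length P) i)) len)
         (indifferent S′⊆S same) (endHomogeneous S′⊆S)
         (⊆-trans (ʳ++⁺ (⊆-refl {x = y ∷ P}) S′⊆S) sub) s≤
    where
      s = suc q ^ (i * n ^ j)
      g : List A → A → Fin q
      g zs w = χ (w ∷ y ∷ zs)
      gs = map g (combs j P)
      P≤n : length P ≤ n
      P≤n = subst (length P ≤_) len (m≤m+n (length P) (suc i))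
      0<n : 0 < n
      0<n = subst (0 <_) len (≤-trans (s≤s z≤n) (m≤n+m (suc i) (length P)))
      gs≤ : length gs ≤ n ^ j
      gs≤ = ≤-trans (≤-reflexive (length-map g (combs j P)))
              (≤-trans (length-combs j P) (^-monoˡ-≤ j P≤n))
      enough : q ^ length gs * s ≤ length S
      enough = ≤-trans (*-monoˡ-≤ s (^-monoʳ-≤ q {{>-nonZero 0<q}} gs≤))
        (≤-pred (≤-trans (q^e*s<1+q^e*s q (n ^ j) s (m^n>0 n {{>-nonZero 0<n}} j) (m^n>0 (suc q) (i * n ^ j)))
          (≤-trans (≤-reflexive (sym (^-distribˡ-+-* (suc q) (n ^ j) (i * n ^ j)))) big)))
      indifferent : ∀ {S′} → S′ ⊆ S →
        (∀ {h} → h ∈ gs → ∀ {w w′} → w ∈ S′ → w′ ∈ S′ → h w ≡ h w′) → Indifferent (y ∷ P) S′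
      indifferent S′⊆S same (.y ∷ʳ τ) eq w∈ w′∈ =
        ind τ eq (there (⊆-lookup S′⊆S w∈)) (there (⊆-lookup S′⊆S w′∈))
      indifferent S′⊆S same {zs = .y ∷ zs} (refl ∷ τ) eq w∈ w′∈ =
        same (∈-map⁺ g (subst (λ l → zs ∈ combs l P) (suc-injective eq) (∈-combs⁺ τ))) w∈ w′∈
      endHomogeneous : ∀ {S′} → S′ ⊆ S → EndHomogeneous (y ∷ P) S′
      endHomogeneous S′⊆S (.y ∷ʳ τ)  eq w′∈ = end τ eq (there (⊆-lookup S′⊆S w′∈))
      -- The new pick `y` was itself a candidate, so the old indifference already equates it with
      -- every survivor.
      endHomogeneous S′⊆S (refl ∷ τ) eq w′∈ = ind τ eq (here refl) (there (⊆-lookup S′⊆S w′∈))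

Homogeneous : (List A → Fin q) → ℕ → Fin q → List A → Set
Homogeneous χ k c ys = ∀ {zs} → zs ⊆ ys → length zs ≡ k → χ zs ≡ c

-- ramsey q j l bounds the Ramsey number of lists of length l in uniformity j + 1.
ramsey : ℕ → ℕ → ℕ → ℕ
ramsey q zero    l = q * l
ramsey q (suc j) l = suc q ^ (ramsey q j l ^ suc j)

ramsey-list : 0 < q → ∀ j l (χ : List A → Fin q) xs → ramsey q j l ≤ length xs →
              ∃₂ λ ys c → ys ⊆ xs × length ys ≡ l × Homogeneous χ (suc j) c ys
ramsey-list 0<q zero l χ xs big =
  let c , large = pigeonhole 0<q (λ x → χ (x ∷ [])) xs l big
      ys = filter (λ x → χ (x ∷ []) ≟ᶠ c) xs
      l-ys⊆ys = take-⊆ l ys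
  in take l ys , c , ⊆-trans l-ys⊆ys (filter-⊆ _ xs) ,
     trans (length-take l ys) (m≤n⇒m⊓n≡m large) , λ
       { {z ∷ []} τ refl → proj₂ (∈-filter⁻ (λ x → χ (x ∷ []) ≟ᶠ c) {xs = xs}
                                   (⊆-lookup (⊆-trans τ l-ys⊆ys) (here refl))) }
ramsey-list {q = q} {A = A} 0<q (suc j) l χ xs big
  -- `pick` puts its latest choice in front; drawing from the reversed list makes `P` a sublist of
  -- `xs` in the original order.
  with ErdősRado.pick 0<q j χ r (reverse xs) r [] (reverse xs) refl (λ { [] () }) (λ ()) ⊆-refl
         (subst (suc q ^ (r ^ suc j) ≤_) (sym (length-reverse xs)) big)
  where r = ramsey q j l
... | P , w₀ ∷ S , P≡n , end , sub , _ =
  -- By end-homogeneity the survivor `w₀` can replace the head of any sublist of `P` of the right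
  -- length, so prefixing `w₀` lowers the uniformity by one.
  let ys , c , ys⊆P , l≤ , hom = ramsey-list 0<q j l (λ zs → χ (w₀ ∷ zs)) P (≤-reflexive (sym P≡n))
  in ys , c , ⊆-trans ys⊆P P⊆xs , l≤ , λ
       { {z ∷ zs} τ eq → trans (end (⊆-trans τ ys⊆P) (suc-injective eq) (here refl))
                               (hom (⊆-trans (z ∷ʳ ⊆-refl) τ) (suc-injective eq)) }
  where
    P⊆xs : P ⊆ xs
    P⊆xs = reverse⁻ (⊆-trans (ʳ++⁺ (⊆-refl {x = P}) (minimum (w₀ ∷ S))) sub)

-- Complete multipartite structures in dense relations

-- Double counting yields a `w` related to at least a proportion `1 / E` of `X`. Removing it from
-- `W` lowers each `E * count` by at most `E`, which the slack `E * n` pays for, while `M` stays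
-- fixed. The permutation `W ↭ U ++ W′` records that `U` uses no entry of `W` twice.
greedy-choice : ∀ n (W : List A) (X : List B) (P : A → B → Bool) {M E} →
  length W ≤ M → 0 < E → 0 < length X →
  (∀ {x} → x ∈ X → M + E * n ≤ E * count (λ w → P w x) W) →
  ∃₂ λ U W′ → W ↭ U ++ W′ × length U ≡ n ×
    length X ≤ E ^ n * count (λ x → all (λ u → P u x) U) X
greedy-choice zero W X P W≤ 0<E 0<X rich = [] , W , ↭-refl , refl ,
  ≤-reflexive (sym (trans (*-identityˡ _) (trans (∑-const X 1) (*-identityʳ _))))
greedy-choice (suc n) W X@(x₀ ∷ _) P {M} {E} W≤ 0<E 0<X rich =
  let w , w∈W , X≤ = ≤-average W (λ w → E * count (P w) X) (length X) 0<W average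
      W₁ , W↭ = ∈-↭∷ w∈W
      X₁ = filter (T? ∘ P w) X
      X≤′ = subst (λ c → length X ≤ E * c) (sym (length-filter≡count (T? ∘ P w) X)) X≤
      U , W₂ , W₁↭ , len , X₁≤ = greedy-choice n W₁ X₁ P
        (≤-trans (n≤1+n _) (≤-trans (≤-reflexive (sym (↭-length W↭))) W≤)) 0<E
        (pos X≤′) (λ x∈ → rich′ W↭ (proj₁ (∈-filter⁻ (T? ∘ P w) {xs = X} x∈)))
  in w ∷ U , W₂ , ↭-trans W↭ (prep w W₁↭) , cong suc len , (begin
       length X                 ≤⟨ X≤′ ⟩
       E * length X₁            ≤⟨ *-monoʳ-≤ E X₁≤ ⟩
       E * (E ^ n * count (λ x → all (λ u → P u x) U) X₁)
         ≡⟨ cong (λ c → E * (E ^ n * c)) (count-filter (T? ∘ P w) _ X) ⟩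
       E * (E ^ n * count (λ x → all (λ u → P u x) (w ∷ U)) X)
         ≡⟨ *-assoc E (E ^ n) _ ⟨
       E ^ suc n * count (λ x → all (λ u → P u x) (w ∷ U)) X ∎)
  where
    open ≤-Reasoning
    0<W : 0 < length W
    0<W = ∑-pos W (count>0 (≤-trans (m≤m*n E (suc n)) (≤-trans (m≤n+m _ M) (rich (here refl)))))
      where
        count>0 : ∀ {c} → E ≤ E * c → 0 < c
        count>0 {zero}  E≤ with () ← ≤-trans 0<E (≤-trans E≤ (≤-reflexive (*-zeroʳ E)))
        count>0 {suc _} _  = s≤s z≤n
        ∑-pos : ∀ (W : List A) {f} → 0 < ∑ W f → 0 < length W
        ∑-pos (_ ∷ _) _ = s≤s z≤n
    average : length W * length X ≤ ∑ W (λ w → E * count (P w) X)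
    average = begin
      length W * length X                 ≡⟨ *-comm (length W) (length X) ⟩
      length X * length W                 ≤⟨ *-monoʳ-≤ (length X) W≤ ⟩
      length X * M
        ≤⟨ ∑-bounded-below X _ M (λ x x∈ → ≤-trans (m≤m+n M _) (rich x∈)) ⟩
      ∑ X (λ x → E * count (λ w → P w x) W) ≡⟨ ∑-*ˡ X E _ ⟩
      E * ∑ X (λ x → count (λ w → P w x) W) ≡⟨ cong (E *_) (∑-swap X W _) ⟩
      E * ∑ W (λ w → count (P w) X)       ≡⟨ ∑-*ˡ W E _ ⟨
      ∑ W (λ w → E * count (P w) X)       ∎
    pos : ∀ {c} → length X ≤ E * c → 0 < c
    pos {zero}  X≤ with () ← ≤-trans 0<X (≤-trans X≤ (≤-reflexive (*-zeroʳ E)))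
    pos {suc _} X≤ = s≤s z≤n
    rich′ : ∀ {w W₁} → W ↭ w ∷ W₁ → ∀ {x} → x ∈ X → M + E * n ≤ E * count (λ w → P w x) W₁
    rich′ {w} {W₁} W↭ {x} x∈ = +-cancelˡ-≤ E _ _ (begin
      E + (M + E * n)                            ≡⟨ rearrange E M n ⟩
      M + E * suc n                              ≤⟨ rich x∈ ⟩
      E * count (λ w → P w x) W                  ≡⟨ cong (E *_) (∑-↭ _ W↭) ⟩
      E * (ind (P w x) + count (λ w → P w x) W₁) ≤⟨ *-monoʳ-≤ E (+-monoˡ-≤ _ (ind≤1 (P w x))) ⟩
      E * suc (count (λ w → P w x) W₁)           ≡⟨ *-suc E _ ⟩
      E + E * count (λ w → P w x) W₁             ∎)
      where
        rearrange : ∀ E M n → E + (M + E * n) ≡ M + E * suc n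
        rearrange = solve-∀

-- Those `x` with `2 * D * g x` below `M` contribute at most half of the guaranteed total
-- `length X * M / D`. The others must supply the remaining half, with at most `M` each.
many-rich : ∀ (X : List B) (g : B → ℕ) D M → 0 < M → (∀ x → g x ≤ M) →
            length X * M ≤ D * ∑ X g →
            length X ≤ 2 * D * count (λ x → M ≤ᵇ 2 * D * g x) X
many-rich X g D M 0<M g≤M dense = *-cancelʳ-≤ _ _ M {{>-nonZero 0<M}}
  (+-cancelʳ-≤ (length X * M) _ _ (begin
    length X * M + length X * M      ≤⟨ +-mono-≤ dense dense ⟩
    D * ∑ X g + D * ∑ X g            ≡⟨ double D (∑ X g) ⟩
    2 * D * ∑ X g                    ≡⟨ ∑-*ˡ X (2 * D) g ⟨
    ∑ X (λ x → 2 * D * g x)          ≤⟨ ∑-mono X (λ x _ → split x) ⟩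
    ∑ X (λ x → 2 * D * M * ind (good x) + M) ≡⟨ ∑-+ X _ _ ⟩
    ∑ X (λ x → 2 * D * M * ind (good x)) + ∑ X (λ _ → M)
                                     ≡⟨ cong₂ _+_ (∑-*ˡ X (2 * D * M) _) (∑-const X M) ⟩
    2 * D * M * count good X + length X * M
                                     ≡⟨ cong (_+ length X * M) (swap D M (count good X)) ⟩
    2 * D * count good X * M + length X * M ∎))
  where
    open ≤-Reasoning
    good = λ x → M ≤ᵇ 2 * D * g x
    double : ∀ D s → D * s + D * s ≡ 2 * D * s
    double = solve-∀
    swap : ∀ D M c → 2 * D * M * c ≡ 2 * D * c * M
    swap = solve-∀
    split : ∀ x → 2 * D * g x ≤ 2 * D * M * ind (good x) + M
    split x with M ≤ᵇ 2 * D * g x in eq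
    ... | true  = ≤-trans (*-monoʳ-≤ (2 * D) (g≤M x))
                    (≤-trans (≤-reflexive (sym (*-identityʳ _))) (m≤m+n _ M))
    ... | false = ≤-trans (<⇒≤ (≰⇒> λ M≤ → subst T eq (≤⇒≤ᵇ M≤))) (m≤n+m M _)

count≤length : ∀ (P : A → Bool) xs → count P xs ≤ length xs
count≤length P xs = subst (count P xs ≤_) (*-identityʳ _) (∑-bounded xs _ 1 (λ x _ → ind≤1 (P x)))

count-∧ʳ : ∀ (P Q : A → Bool) xs → count (λ x → P x ∧ Q x) xs ≤ count Q xs
count-∧ʳ P Q xs = ∑-mono xs (λ x _ → lemma (P x))
  where
    lemma : ∀ b {c} → ind (b ∧ c) ≤ ind c
    lemma true  = ≤-refl
    lemma false = z≤n

-- Only the rich `x`, with `2 * D * deg x ≥ M`, are kept. The greedy choice then runs with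
-- `E = 4 * D`: one half of `4 * D * deg x` covers `M`, and the other half covers the slack
-- `4 * D * n`, which is at most `M` by assumption.
dense-choice : ∀ n (W : List A) (X : List B) (P : A → B → Bool) D → 0 < D → 0 < length X →
  0 < length W → 4 * D * n ≤ length W →
  length X * length W ≤ D * ∑ X (λ x → count (λ w → P w x) W) →
  ∃₂ λ U W′ → W ↭ U ++ W′ × length U ≡ n ×
    length X ≤ 2 * D * (4 * D) ^ n * count (λ x → all (λ u → P u x) U) X
dense-choice n W X P D 0<D 0<X 0<W W-large dense =
  let U , W′ , W↭ , len , X₁≤ = greedy-choice n W X₁ P ≤-refl (≤-trans 0<D (m≤n*m D 4)) 0<X₁ rich
  in U , W′ , W↭ , len , (begin
       length X                         ≤⟨ X≤ ⟩
       2 * D * length X₁                ≤⟨ *-monoʳ-≤ (2 * D) X₁≤ ⟩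
       2 * D * ((4 * D) ^ n * count (λ x → all (λ u → P u x) U) X₁)
         ≡⟨ *-assoc (2 * D) ((4 * D) ^ n) _ ⟨
       2 * D * (4 * D) ^ n * count (λ x → all (λ u → P u x) U) X₁
         ≡⟨ cong (2 * D * (4 * D) ^ n *_) (count-filter (T? ∘ good) _ X) ⟩
       2 * D * (4 * D) ^ n * count (λ x → good x ∧ all (λ u → P u x) U) X
         ≤⟨ *-monoʳ-≤ (2 * D * (4 * D) ^ n) (count-∧ʳ good _ X) ⟩
       2 * D * (4 * D) ^ n * count (λ x → all (λ u → P u x) U) X ∎)
  where
    open ≤-Reasoning
    M = length W
    deg = λ x → count (λ w → P w x) W
    good = λ x → M ≤ᵇ 2 * D * deg x
    X₁ = filter (T? ∘ good) X
    X≤ : length X ≤ 2 * D * length X₁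
    X≤ = subst (λ c → length X ≤ 2 * D * c) (sym (length-filter≡count (T? ∘ good) X))
      (many-rich X deg D M 0<W (λ x → count≤length (λ w → P w x) W) dense)
    0<X₁ : 0 < length X₁
    0<X₁ with length X₁ | X≤
    ... | zero  | X≤0 with () ← ≤-trans 0<X (≤-trans X≤0 (≤-reflexive (*-zeroʳ (2 * D))))
    ... | suc _ | _ = s≤s z≤n
    rich : ∀ {x} → x ∈ X₁ → M + 4 * D * n ≤ 4 * D * deg x
    rich {x} x∈ = begin
      M + 4 * D * n                  ≤⟨ +-mono-≤ M≤ (≤-trans W-large M≤) ⟩
      2 * D * deg x + 2 * D * deg x  ≡⟨ double D (deg x) ⟩
      4 * D * deg x                  ∎
      where
        M≤ : M ≤ 2 * D * deg x
        M≤ = ≤ᵇ⇒≤ M _ (proj₂ (∈-filter⁻ (T? ∘ good) {xs = X} x∈))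
        double : ∀ D s → 2 * D * s + 2 * D * s ≡ 4 * D * s
        double = solve-∀

Unique-resp-↭ : ∀ {xs ys : List A} → xs ↭ ys → Unique xs → Unique ys
Unique-resp-↭ p = Permutation.Unique-resp-↭ (setoid _) (↭⇒↭ₛ p)

Unique-++⁻ˡ : ∀ (xs : List A) {ys} → Unique (xs ++ ys) → Unique xs
Unique-++⁻ˡ []       _        = []
Unique-++⁻ˡ (x ∷ xs) (x∉ ∷ u) = ++⁻ˡ xs x∉ ∷ Unique-++⁻ˡ xs u

n<2^n : ∀ n → n < 2 ^ n
n<2^n zero    = s≤s z≤n
n<2^n (suc n) = ≤-trans (+-mono-≤ (m^n>0 2 n) (n<2^n n)) (≤-reflexive (cong (2 ^ n +_) (sym (+-identityʳ _))))

-- Increasing injections from `Fin l` to `Fin R`, given coordinate by coordinate so that `blow-up`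
-- can recurse on them together with the vectors.
data _↪_ : ℕ → ℕ → Set where
  done : 0 ↪ 0
  keep : l ↪ R → suc l ↪ suc R
  skip : l ↪ R → l ↪ suc R

embed : l ↪ R → Fin l → Fin R
embed (keep θ) zero    = zero
embed (keep θ) (suc j) = suc (embed θ j)
embed (skip θ) j       = suc (embed θ j)

vecs : ∀ M R → List (Vec (Fin M) R)
vecs M zero    = [] ∷ []
vecs M (suc R) = cartesianProductWith _∷_ (allFin M) (vecs M R)

length-vecs : ∀ M R → length (vecs M R) ≡ M ^ R
length-vecs M zero    = refl
length-vecs M (suc R) = trans (length-product _∷_ (allFin M) (vecs M R))
  (cong₂ _*_ (length-allFin M) (length-vecs M R))

weight : Vec ℕ l → ℕ
weight []       = 1
weight (c ∷ cs) = 3 * (2 + c) * weight cs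

weight>0 : ∀ (cs : Vec ℕ l) → 0 < weight cs
weight>0 []       = s≤s z≤n
weight>0 (c ∷ cs) = *-mono-< {0} {3 * (2 + c)} {0} {weight cs} (s≤s z≤n) (weight>0 cs)

module _ {D : ℕ} (2≤D : 2 ≤ D) where
  -- The origin of the factor 3 in `weight`: for `2 ≤ D` the numerical constants are absorbed into
  -- powers of `D`, and `4 * D` turns into `D ^ 3`.
  4D≤D³ : 4 * D ≤ D ^ 3
  4D≤D³ = begin
    4 * D       ≤⟨ *-monoˡ-≤ D (*-mono-≤ 2≤D 2≤D) ⟩
    D * D * D   ≡⟨ cube D ⟩
    D ^ 3       ∎
    where
      open ≤-Reasoning
      cube : ∀ D → D * D * D ≡ D * (D * (D * 1))
      cube = solve-∀

  density-loss : ∀ n → 2 * D * (4 * D) ^ n ≤ D ^ (3 * suc n)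
  density-loss n = begin
    2 * D * (4 * D) ^ n       ≤⟨ *-monoˡ-≤ ((4 * D) ^ n) (*-monoˡ-≤ D {2} {4} (s≤s (s≤s z≤n))) ⟩
    (4 * D) ^ suc n           ≤⟨ ^-monoˡ-≤ (suc n) 4D≤D³ ⟩
    (D ^ 3) ^ suc n           ≡⟨ ^-*-assoc D 3 (suc n) ⟩
    D ^ (3 * suc n)           ∎
    where open ≤-Reasoning

  4Dn≤ : ∀ n → 4 * D * n ≤ D ^ (3 * suc n)
  4Dn≤ n = begin
    4 * D * n         ≤⟨ *-mono-≤ 4D≤D³ (<⇒≤ (n<2^n n)) ⟩
    D ^ 3 * 2 ^ n     ≤⟨ *-monoʳ-≤ (D ^ 3) (^-monoˡ-≤ n 2≤D) ⟩
    D ^ 3 * D ^ n     ≡⟨ ^-distribˡ-+-* D 3 n ⟨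
    D ^ (3 + n)
      ≤⟨ ^-monoʳ-≤ D {{>-nonZero (≤-trans (s≤s z≤n) 2≤D)}} (≤-trans (+-monoʳ-≤ 3 (m≤n*m n 3)) (≤-reflexive (sym (*-suc 3 n)))) ⟩
    D ^ (3 * suc n)   ∎
    where
      open ≤-Reasoning

-- Parts outside the range of `embed θ` carry lists as well, since `P` reads all `R` coordinates;
-- there a single vertex suffices.
Blow-up : ∀ {M} → l ↪ R → Vec ℕ l → (Vec (Fin M) R → Bool) → Set
Blow-up {R = R} {M = M} θ cs P = ∃ λ (U : Fin R → List (Fin M)) →
  (∀ i → Unique (U i)) × (∀ i → 0 < length (U i)) ×
  (∀ j → lookup cs j < length (U (embed θ j))) ×
  (∀ x → (∀ i → lookup x i ∈ U i) → T (P x))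

blow-up : ∀ {M} (θ : l ↪ R) (cs : Vec ℕ l) D → 2 ≤ D → (P : Vec (Fin M) R → Bool) →
  length (vecs M R) ≤ D * count P (vecs M R) → D ^ weight cs ≤ M → Blow-up θ cs P
blow-up done [] D 2≤D P dense _ = (λ ()) , (λ ()) , (λ ()) , (λ ()) , λ { [] _ → holds dense }
  where
    holds : 1 ≤ D * count P ([] ∷ []) → T (P [])
    holds dense with P []
    ... | true  = _
    ... | false with () ← ≤-trans dense (≤-reflexive (*-zeroʳ D))
-- At a skipped coordinate one vertex `w` of at least average density is fixed, which leaves `D`
-- unchanged.
blow-up {R = suc R} {M = M} (skip θ) cs D 2≤D P dense large =
  let w , _ , dense′ = ≤-average (allFin M) (λ w → D * count (P ∘ (w ∷_)) (vecs M R)) (length (vecs M R))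
        (subst (0 <_) (sym (length-allFin M))
          (≤-trans (m^n>0 D {{>-nonZero (≤-trans (s≤s z≤n) 2≤D)}} (weight cs)) large)) (begin
          length (allFin M) * length (vecs M R)     ≡⟨ length-product _∷_ (allFin M) (vecs M R) ⟨
          length (vecs M (suc R))                   ≤⟨ dense ⟩
          D * count P (vecs M (suc R))
            ≡⟨ cong (D *_) (∑-product _∷_ (allFin M) (vecs M R) _) ⟩
          D * ∑ (allFin M) (λ w → count (P ∘ (w ∷_)) (vecs M R)) ≡⟨ ∑-*ˡ (allFin M) D _ ⟨
          ∑ (allFin M) (λ w → D * count (P ∘ (w ∷_)) (vecs M R)) ∎)
      U , uniq , pos , big , hit = blow-up θ cs D 2≤D (P ∘ (w ∷_)) dense′ large
  in (λ { zero → w ∷ [] ; (suc i) → U i }) , (λ { zero → [] ∷ [] ; (suc i) → uniq i }) ,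
     (λ { zero → s≤s z≤n ; (suc i) → pos i }) , big ,
     λ { (v ∷ x) x∈ → helper (x∈ zero) (hit x (x∈ ∘ suc)) }
  where
    open ≤-Reasoning
    helper : ∀ {v w x} → v ∈ w ∷ [] → T (P (w ∷ x)) → T (P (v ∷ x))
    helper (here refl) eq = eq
blow-up {R = suc R} {M = M} (keep θ) (c ∷ cs) D 2≤D P dense large =
  -- With `e = 3 * (2 + c)`, `4Dn≤` leaves room for choosing `suc c` of the `M` vertices, and
  -- `density-loss` lets the recursion continue with `D ^ e` in place of `D`. Hence the exponents
  -- multiply, as in `weight`.
  step (3 * (2 + c)) (s≤s z≤n) (4Dn≤ 2≤D (suc c)) (density-loss 2≤D (suc c)) large
  where
  open ≤-Reasoning
  0<D : 0 < D
  0<D = ≤-trans (s≤s z≤n) 2≤D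
  extend : ∀ U₀ W′ → allFin M ↭ U₀ ++ W′ → length U₀ ≡ suc c →
           Blow-up θ cs (λ x → all (λ u → P (u ∷ x)) U₀) → Blow-up (keep θ) (c ∷ cs) P
  extend U₀ W′ W↭ len (U , uniq , pos , big , hit) =
    (λ { zero → U₀ ; (suc i) → U i }) ,
    (λ { zero → Unique-++⁻ˡ U₀ (Unique-resp-↭ W↭ (Unique.allFin⁺ M)) ; (suc i) → uniq i }) ,
    (λ { zero → subst (0 <_) (sym len) (s≤s z≤n) ; (suc i) → pos i }) ,
    (λ { zero → ≤-reflexive (sym len) ; (suc j) → big j }) ,
    λ { (v ∷ x) x∈ → All.lookup (all⁺ (λ u → P (u ∷ x)) U₀ (hit x (x∈ ∘ suc))) (x∈ zero) }
  step : ∀ e → 0 < e → 4 * D * suc c ≤ D ^ e → 2 * D * (4 * D) ^ suc c ≤ D ^ e → D ^ (e * weight cs) ≤ M →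
         Blow-up (keep θ) (c ∷ cs) P
  step e 0<e room loss large = choose (dense-choice (suc c) (allFin M) (vecs M R) (λ w x → P (w ∷ x)) D 0<D
    (subst (0 <_) (sym (length-vecs M R)) (m^n>0 M {{>-nonZero 0<M}} R))
    (subst (0 <_) (sym (length-allFin M)) 0<M)
    (subst (4 * D * suc c ≤_) (sym (length-allFin M)) (≤-trans room large₁)) (begin
      length (vecs M R) * length (allFin M)     ≡⟨ *-comm (length (vecs M R)) _ ⟩
      length (allFin M) * length (vecs M R)     ≡⟨ length-product _∷_ (allFin M) (vecs M R) ⟨
      length (vecs M (suc R))                   ≤⟨ dense ⟩
      D * count P (vecs M (suc R))              ≡⟨ cong (D *_) (∑-product _∷_ (allFin M) (vecs M R) _) ⟩
      D * ∑ (allFin M) (λ w → count (P ∘ (w ∷_)) (vecs M R))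
        ≡⟨ cong (D *_) (∑-swap (allFin M) (vecs M R) _) ⟩
      D * ∑ (vecs M R) (λ x → count (λ w → P (w ∷ x)) (allFin M)) ∎))
    where
      2≤D₁ : 2 ≤ D ^ e
      2≤D₁ = ≤-trans 2≤D (≤-trans (≤-reflexive (sym (^-identityʳ D))) (^-monoʳ-≤ D {{>-nonZero 0<D}} 0<e))
      large₂ : (D ^ e) ^ weight cs ≤ M
      large₂ = subst (_≤ M) (sym (^-*-assoc D e (weight cs))) large
      large₁ : D ^ e ≤ M
      large₁ = ≤-trans (≤-trans (≤-reflexive (sym (^-identityʳ (D ^ e))))
        (^-monoʳ-≤ (D ^ e) {{>-nonZero (≤-trans (s≤s z≤n) 2≤D₁)}} (weight>0 cs))) large₂
      0<M : 0 < M
      0<M = ≤-trans (≤-trans (s≤s z≤n) 2≤D₁) large₁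
      choose : (∃₂ λ U₀ W′ → allFin M ↭ U₀ ++ W′ × length U₀ ≡ suc c × length (vecs M R) ≤
        2 * D * (4 * D) ^ suc c * count (λ x → all (λ u → P (u ∷ x)) U₀) (vecs M R)) →
        Blow-up (keep θ) (c ∷ cs) P
      choose (U₀ , W′ , W↭ , len , dense′) = extend U₀ W′ W↭ len
        (blow-up θ cs (D ^ e) 2≤D₁ (λ x → all (λ u → P (u ∷ x)) U₀)
          (≤-trans dense′ (*-monoˡ-≤ _ loss)) large₂)

-- Counting the entries of a list that lie outside another list

module _ (_≟ᴬ_ : DecidableEquality A) where
  open DecMembership _≟ᴬ_ using (_∈?_; _∉?_)

  -- Every entry of `xs` found in `ys` is charged to an occurrence there, which is then deleted. As
  -- `xs` has no duplicates, the deletion does not affect membership of its later entries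
  -- (`antitone`).
  length≤length+outside : ∀ (xs ys : List A) → Unique xs →
    length xs ≤ length ys + length (filter (_∉? ys) xs)
  length≤length+outside xs ys u = subst (λ c → length xs ≤ length ys + c)
    (sym (length-filter≡count (_∉? ys) xs)) (go xs ys u)
    where
      antitone : ∀ {x} {y} {ys zs : List A} → ys ↭ x ∷ zs → x ≢ y →
                 ind (does (y ∉? zs)) ≤ ind (does (y ∉? ys))
      antitone {x} {y} {ys} {zs} p x≢y with y ∈? ys
      ... | no _ = ind≤1 _
      ... | yes y∈ys with y ∈? zs
      ...   | yes _ = z≤n
      ...   | no y∉zs with ∈-resp-↭ p y∈ys
      ...     | here refl  = ⊥-elim (x≢y refl)
      ...     | there y∈zs = ⊥-elim (y∉zs y∈zs)
      go : ∀ xs ys → Unique xs → length xs ≤ length ys + count (does ∘ (_∉? ys)) xs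
      go []       ys u        = z≤n
      go (x ∷ xs) ys (x∉ ∷ u) with x ∈? ys
      ... | no _ = ≤-trans (s≤s (go xs ys u)) (≤-reflexive (sym (+-suc _ _)))
      ... | yes x∈ys =
        let zs , p = ∈-↭∷ x∈ys
        in subst (λ l → suc (length xs) ≤ l + count (does ∘ (_∉? ys)) xs) (sym (↭-length p))
             (s≤s (≤-trans (go xs zs u) (+-monoʳ-≤ (length zs)
               (∑-mono xs λ y y∈ → antitone p (All.lookup x∉ y∈)))))

-- Rainbow colourings with prescribed class capacities

-- This is the last place of class `j`. Places are numbered from 0, so the class has one place more.
capacity : ℕ → ℕ → ℕ
capacity K j = K * K / (suc j * suc j)

square-cancel-≤ : ∀ {m n} → m * m ≤ n * n → m ≤ n
square-cancel-≤ m²≤n² = ≮⇒≥ λ n<m → <⇒≱ (*-mono-< n<m n<m) m²≤n²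

module _ (a t D K : ℕ) (a≤t : a ≤ t) (at≤D : a * suc t ≤ D) (t<D : suc t ≤ D) (9D≤K² : 9 * D ≤ K * K) where
  private
    L c : ℕ
    L = suc (2 * a)
    c = capacity K (2 * a)

    K²<cL² : K * K < suc c * (L * L)
    K²<cL² = begin-strict
      K * K                                      ≡⟨ m≡m%n+[m/n]*n (K * K) (L * L) ⟩
      K * K % (L * L) + K * K / (L * L) * (L * L) <⟨ +-monoˡ-< _ (m%n<n (K * K) (L * L)) ⟩
      suc c * (L * L)                            ∎
      where open ≤-Reasoning

    L²≤9a² : 0 < a → L * L ≤ 9 * (a * a)
    L²≤9a² 0<a = ≤-trans (*-mono-≤ L≤3a L≤3a) (≤-reflexive (square a))
      where
        L≤3a : L ≤ 3 * a
        L≤3a = +-monoˡ-≤ (2 * a) 0<a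
        square : ∀ a → 3 * a * (3 * a) ≡ 9 * (a * a)
        square = solve-∀

  2a+1≤K : L ≤ K
  2a+1≤K with a ≟ 0
  ... | yes refl = square-cancel-≤ (≤-trans (≤-trans (≤-trans (s≤s z≤n) t<D) (m≤n*m D 9)) 9D≤K²)
  ... | no  a≢0  = square-cancel-≤ (≤-trans (L²≤9a² (n≢0⇒n>0 a≢0)) (≤-trans (*-monoʳ-≤ 9
                     (≤-trans (*-monoʳ-≤ a (≤-trans a≤t (n≤1+n t))) at≤D)) 9D≤K²))

  -- For `a > 0`, `L ≤ 3 * a` gives `suc c > K² / L² ≥ 9 * D / (9 * a²) ≥ suc t / a`, so already `a
  -- * suc c` exceeds `t`. The 9 in `9 * D ≤ K * K` is the square of this 3. For `a =
  -- 0` the single class 0 has more than `K * K` places.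
  enough-slots : t < suc a * suc c
  enough-slots with a ≟ 0
  ... | yes refl = ≤-trans t<D (≤-trans (m≤n*m D 9) (≤-trans 9D≤K²
                     (≤-trans (<⇒≤ K²<cL²) (≤-reflexive (ones c)))))
    where
      ones : ∀ c → suc c * 1 ≡ 1 * suc c
      ones = solve-∀
  ... | no  a≢0  = ≤-trans (*-cancelˡ-≤ a {{>-nonZero 0<a}} (≤-trans at≤D (*-cancelˡ-≤ 9 (≤-trans 9D≤K²
                     (≤-trans (<⇒≤ K²<cL²) (≤-trans (*-monoʳ-≤ (suc c) (L²≤9a² 0<a))
                       (≤-reflexive (rearrange a c))))))))
                     (*-monoˡ-≤ (suc c) (n≤1+n a))
    where
      0<a = n≢0⇒n>0 a≢0
      rearrange : ∀ a c → suc c * (9 * (a * a)) ≡ 9 * (a * (a * suc c))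
      rearrange = solve-∀

module Placement (_≟ᴬ_ : DecidableEquality A) (adj : A → A → Bool)
  (adj-sym : ∀ {v w} → T (adj v w) → T (adj w v)) (adj-irrefl : ∀ {v} → ¬ T (adj v v))
  (D K : ℕ) (9D≤K² : 9 * D ≤ K * K) where

  -- (j , s) stands for the s-th place in the j-th colour class.
  record Placed (X : List A) (φ : A → ℕ × ℕ) : Set where
    field
      colour<  : ∀ {v} → v ∈ X → proj₁ (φ v) < K
      place≤   : ∀ {v} → v ∈ X → proj₂ (φ v) ≤ capacity K (proj₁ (φ v))
      distinct : ∀ {v w} → v ∈ X → w ∈ X → v ≢ w → φ v ≢ φ w
      proper   : ∀ {v w} → v ∈ X → w ∈ X → T (adj v w) → proj₁ (φ v) ≢ proj₁ (φ w)

  Extends : (A → ℕ × ℕ) → A → List A → ℕ × ℕ → Set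
  Extends φ v X (j , s) = j < K × s ≤ capacity K j × (∀ {w} → w ∈ X → (j , s) ≢ φ w) ×
    (∀ {w} → w ∈ X → T (adj v w) → j ≢ proj₁ (φ w))

  free-slot : ∀ φ v X → suc (length X) ≤ D → count (adj v) X * suc (length X) ≤ D →
              ∃ (Extends φ v X)
  free-slot φ v X t<D at≤D = pick free refl
    where
      a = count (adj v) X
      c = capacity K (2 * a)
      neighbours = filter (T? ∘ adj v) X
      forbidden = map (proj₁ ∘ φ) neighbours
      open DecMembership _≟_ using () renaming (_∉?_ to _∉ℕ?_)
      open DecMembership (≡-dec _≟_ _≟_) using () renaming (_∉?_ to _∉×?_)
      colours = filter (_∉ℕ? forbidden) (upTo (suc (2 * a)))
      -- `c` is the capacity of class `2 * a`, the least among the classes considered, so each of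
      -- these places exists in every one of them.
      slots = cartesianProduct colours (upTo (suc c))
      free = filter (_∉×? map φ X) slots
      a≤t : a ≤ length X
      a≤t = count≤length (adj v) X
      forbidden≡a : length forbidden ≡ a
      forbidden≡a = trans (length-map _ neighbours) (length-filter≡count (T? ∘ adj v) X)
      open ≤-Reasoning
      many-colours : suc a ≤ length colours
      many-colours = +-cancelˡ-≤ a _ _ (begin
        a + suc a                          ≡⟨ arith a ⟩
        suc (2 * a)                        ≡⟨ length-upTo (suc (2 * a)) ⟨
        length (upTo (suc (2 * a)))        ≤⟨ length≤length+outside _≟_ _ forbidden (Unique.upTo⁺ _) ⟩
        length forbidden + length colours  ≡⟨ cong (_+ length colours) forbidden≡a ⟩
        a + length colours                 ∎)
        where
          arith : ∀ a → a + suc a ≡ suc (2 * a)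
          arith = solve-∀
      0<free : 0 < length free
      0<free = +-cancelˡ-< (length X) _ _ (begin-strict
        length X + 0               ≡⟨ +-identityʳ _ ⟩
        length X                   <⟨ enough-slots a (length X) D K a≤t at≤D t<D 9D≤K² ⟩
        suc a * suc c              ≤⟨ *-mono-≤ many-colours (≤-reflexive (sym (length-upTo (suc c)))) ⟩
        length colours * length (upTo (suc c)) ≡⟨ length-product _,_ colours _ ⟨
        length slots               ≤⟨ length≤length+outside (≡-dec _≟_ _≟_) slots (map φ X)
                                        (Unique.cartesianProduct⁺ (Unique.filter⁺ (_∉ℕ? forbidden) (Unique.upTo⁺ (suc (2 * a))))
                                           (Unique.upTo⁺ (suc c))) ⟩
        length (map φ X) + length free ≡⟨ cong (_+ length free) (length-map φ X) ⟩
        length X + length free     ∎)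
      extends : ∀ {j s} → (j , s) ∈ free → Extends φ v X (j , s)
      extends {j} {s} ∈free with ∈-filter⁻ (_∉×? map φ X) {xs = slots} ∈free
      ... | ∈slots , ∉used with ∈-cartesianProduct⁻ colours (upTo (suc c)) ∈slots
      ... | j∈ , s∈ with ∈-filter⁻ (_∉ℕ? forbidden) {xs = upTo (suc (2 * a))} j∈
      ... | j∈′ , j∉ =
        ≤-trans j< (2a+1≤K a (length X) D K a≤t at≤D t<D 9D≤K²) ,
        ≤-trans (≤-pred (∈-upTo⁻ s∈)) (/-monoʳ-≤ (K * K) (*-mono-≤ j< j<)) ,
        (λ w∈ eq → ∉used (subst (_∈ map φ X) (sym eq) (∈-map⁺ φ w∈))) ,
        (λ w∈ vw eq → j∉ (subst (_∈ forbidden) (sym eq)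
           (∈-map⁺ (proj₁ ∘ φ) (∈-filter⁺ (T? ∘ adj v) w∈ vw))))
        where
          j< : j < suc (2 * a)
          j< = ∈-upTo⁻ j∈′
      pick : ∀ xs → xs ≡ free → ∃ (Extends φ v X)
      pick []            eq with () ← subst (λ xs → 0 < length xs) (sym eq) 0<free
      pick ((j , s) ∷ _) eq = (j , s) , extends (subst ((j , s) ∈_) eq (here refl))

  update : (A → ℕ × ℕ) → A → ℕ × ℕ → A → ℕ × ℕ
  update φ v x w with w ≟ᴬ v
  ... | yes _ = x
  ... | no  _ = φ w

  update-≡ : ∀ φ v x → update φ v x v ≡ x
  update-≡ φ v x with v ≟ᴬ v
  ... | yes _ = refl
  ... | no v≢ = ⊥-elim (v≢ refl)

  update-≢ : ∀ φ {v} x {w} → v ≢ w → update φ v x w ≡ φ w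
  update-≢ φ {v} x {w} v≢w with w ≟ᴬ v
  ... | yes refl = ⊥-elim (v≢w refl)
  ... | no _     = refl

  extend : ∀ {φ v X x} → All (v ≢_) X → Placed X φ → Extends φ v X x →
           Placed (v ∷ X) (update φ v x)
  extend {φ} {v} {X} {x} v∉ P (j< , s≤ , unused , allowed) = record
    { colour<  = λ { (here refl) → subst (λ y → proj₁ y < K) (sym new) j<
                   ; (there v∈)  → subst (λ y → proj₁ y < K) (sym (old v∈)) (P.colour< v∈) }
    ; place≤   = λ { (here refl) → subst (λ y → proj₂ y ≤ capacity K (proj₁ y)) (sym new) s≤
                   ; (there v∈)  → subst (λ y → proj₂ y ≤ capacity K (proj₁ y)) (sym (old v∈)) (P.place≤ v∈) }
    ; distinct = λ
        { (here refl) (here refl) v≢w → ⊥-elim (v≢w refl)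
        ; (here refl) (there w∈)  _   → λ eq → unused w∈ (trans (sym new) (trans eq (old w∈)))
        ; (there w∈)  (here refl) _   → λ eq → unused w∈ (trans (sym new) (trans (sym eq) (old w∈)))
        ; (there v∈)  (there w∈)  v≢w → λ eq → P.distinct v∈ w∈ v≢w (trans (sym (old v∈)) (trans eq (old w∈))) }
    ; proper   = λ
        { (here refl) (here refl) vw → ⊥-elim (adj-irrefl vw)
        ; (here refl) (there w∈)  vw → λ eq → allowed w∈ vw
            (trans (cong proj₁ (sym new)) (trans eq (cong proj₁ (old w∈))))
        ; (there w∈)  (here refl) wv → λ eq → allowed w∈ (adj-sym wv)
            (trans (cong proj₁ (sym new)) (trans (sym eq) (cong proj₁ (old w∈))))
        ; (there v∈)  (there w∈)  vw → λ eq → P.proper v∈ w∈ vw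
            (trans (cong proj₁ (sym (old v∈))) (trans eq (cong proj₁ (old w∈)))) }
    }
    where
      module P = Placed P
      new : update φ v x v ≡ x
      new = update-≡ φ v x
      old : ∀ {w} → w ∈ X → update φ v x w ≡ φ w
      old w∈ = update-≢ φ x (All.lookup v∉ w∈)

  Placed-↭ : ∀ {X Y φ} → Y ↭ X → Placed X φ → Placed Y φ
  Placed-↭ p P = record
    { colour<  = λ v∈ → colour< (∈-resp-↭ p v∈)
    ; place≤   = λ v∈ → place≤ (∈-resp-↭ p v∈)
    ; distinct = λ v∈ w∈ → distinct (∈-resp-↭ p v∈) (∈-resp-↭ p w∈)
    ; proper   = λ v∈ w∈ → proper (∈-resp-↭ p v∈) (∈-resp-↭ p w∈)
    }
    where open Placed P

  degree-sum : List A → ℕ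
  degree-sum X = ∑ X (λ v → count (adj v) X)

  degree-sum-↭ : ∀ {X Y} → X ↭ Y → degree-sum X ≡ degree-sum Y
  degree-sum-↭ {X} p = trans (∑-cong X (λ v → ∑-↭ (ind ∘ adj v) p)) (∑-↭ _ p)

  -- A vertex of minimum degree is removed and put back into one of the first 2a+1 classes,
  -- where a is its degree: a+1 of these avoid its neighbours, and their places outnumber
  -- the vertices already placed.
  place-all : ∀ t X → length X ≡ t → t ≤ D → Unique X → degree-sum X ≤ D → ∃ (Placed X)
  place-all zero    []          len t≤D u deg≤ = (λ _ → 0 , 0) , record
    { colour< = λ () ; place≤ = λ () ; distinct = λ () ; proper = λ () }
  place-all (suc t) X@(_ ∷ _) len t≤D u deg≤
    -- The weighting by `suc t`, the number of vertices of `X`, avoids division: the chosen `v`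
    -- satisfies degree times `suc t` at most `D`, as `free-slot` requires.
    with ≥-average X (λ v → suc t * count (adj v) X) D (s≤s z≤n)
           (≤-trans (≤-reflexive (∑-*ˡ X (suc t) _))
             (≤-trans (*-monoʳ-≤ (suc t) deg≤) (≤-reflexive (cong (_* D) (sym len)))))
  ... | v , v∈ , few with ∈-↭∷ v∈
  ... | Y , p with Unique-resp-↭ p u | suc-injective (trans (sym (↭-length p)) len)
  ... | v∉ ∷ uY | refl with place-all t Y refl (≤-trans (n≤1+n t) t≤D) uY
                              (≤-trans inner≤ (≤-trans (≤-reflexive (sym (degree-sum-↭ p))) deg≤))
    where
      inner≤ : degree-sum Y ≤ degree-sum (v ∷ Y)
      inner≤ = ≤-trans (∑-mono Y λ w _ → m≤n+m _ (ind (adj w v))) (m≤n+m _ (count (adj v) (v ∷ Y)))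
  ... | φ , P with free-slot φ v Y t≤D (≤-trans (≤-reflexive (*-comm _ (suc t)))
                     (≤-trans (*-monoʳ-≤ (suc t) (≤-trans (m≤n+m _ (ind (adj v v)))
                       (≤-reflexive (sym (∑-↭ (ind ∘ adj v) p))))) few))
  ... | x , ext = update φ v x , Placed-↭ p (extend v∉ P ext)

-- The shadow of a hypergraph

∑-allFin-suc : ∀ (f : Fin (suc n) → ℕ) → ∑ (allFin (suc n)) f ≡ f zero + ∑ (allFin n) (f ∘ suc)
∑-allFin-suc {n} f = cong (f zero +_)
  (trans (cong (λ xs → ∑ xs f) (sym (map-tabulate id suc))) (∑-map suc (allFin n) f))

count-lookup≡card : ∀ (e : Subset n) → count (lookup e) (allFin n) ≡ card e
count-lookup≡card []          = refl
count-lookup≡card (true  ∷ e) = trans (∑-allFin-suc (ind ∘ lookup (true ∷ e))) (cong suc (count-lookup≡card e))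
count-lookup≡card (false ∷ e) = trans (∑-allFin-suc (ind ∘ lookup (false ∷ e))) (count-lookup≡card e)

∈⇒T-lookup : ∀ {v} {e : Subset n} → v ∈ˢ e → T (lookup e v)
∈⇒T-lookup v∈e = Equivalence.from T-≡ ([]=⇒lookup v∈e)

adjacent : List (Subset n) → Fin n → Fin n → Bool
adjacent es v w = not (does (v ≟ᶠ w)) ∧ any (λ e → lookup e v ∧ lookup e w) es

ind-∧ : ∀ a b → ind (a ∧ b) ≡ ind a * ind b
ind-∧ true  b = sym (+-identityʳ (ind b))
ind-∧ false b = refl

ind-any≤ : ∀ {A : Set} (P : A → Bool) xs → ind (any P xs) ≤ count P xs
ind-any≤ P []       = z≤n
ind-any≤ P (x ∷ xs) with P x
... | true  = s≤s z≤n
... | false = ind-any≤ P xs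

module Shadow {k m : ℕ} (es : List (Subset n)) (uniform : All (λ e → card e ≡ k) es)
  (size≡m : length es ≡ m) where

  private
    inc : Subset n → Fin n → ℕ
    inc e v = ind (lookup e v)

  ∑-inc : ∀ {e} → e ∈ es → ∑ (allFin n) (inc e) ≡ k
  ∑-inc {e} e∈ = trans (count-lookup≡card e) (All.lookup uniform e∈)

  order≤ : (∀ (v : Fin n) → ∃ λ e → e ∈ es × v ∈ˢ e) → n ≤ m * k
  order≤ covered = begin
    n                                             ≡⟨ length-allFin n ⟨
    length (allFin n)                             ≡⟨ *-identityʳ _ ⟨
    length (allFin n) * 1
      ≤⟨ ∑-bounded-below (allFin n) _ 1 (λ v _ → degree>0 v) ⟩
    ∑ (allFin n) (λ v → ∑ es (λ e → inc e v))     ≡⟨ ∑-swap (allFin n) es _ ⟩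
    ∑ es (λ e → ∑ (allFin n) (inc e))             ≤⟨ ∑-bounded es _ k (λ e e∈ → ≤-reflexive (∑-inc e∈)) ⟩
    length es * k                                 ≡⟨ cong (_* k) size≡m ⟩
    m * k                                         ∎
    where
      open ≤-Reasoning
      degree>0 : ∀ v → 1 ≤ ∑ es (λ e → inc e v)
      degree>0 v with covered v
      ... | e , e∈ , v∈e = ≤-trans (≤-reflexive (cong ind (sym ([]=⇒lookup v∈e)))) (term≤∑ (λ e → inc e v) e∈)

  -- Each ordered adjacent pair is charged to the edges containing both vertices, and an edge
  -- contains `k * k` ordered pairs, counting the diagonal.
  shadow-degree-sum : ∑ (allFin n) (λ v → count (adjacent es v) (allFin n)) ≤ m * (k * k)
  shadow-degree-sum = begin
    ∑ V (λ v → count (adjacent es v) V)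
      ≤⟨ ∑-mono V (λ v _ → ∑-mono V (λ w _ → pair v w)) ⟩
    ∑ V (λ v → ∑ V (λ w → ∑ es (λ e → inc e v * inc e w)))     ≡⟨ ∑-cong V (λ v → ∑-swap V es _) ⟩
    ∑ V (λ v → ∑ es (λ e → ∑ V (λ w → inc e v * inc e w)))     ≡⟨ ∑-swap V es _ ⟩
    ∑ es (λ e → ∑ V (λ v → ∑ V (λ w → inc e v * inc e w)))     ≤⟨ ∑-bounded es _ (k * k) square ⟩
    length es * (k * k)                                        ≡⟨ cong (_* (k * k)) size≡m ⟩
    m * (k * k)                                                ∎
    where
      open ≤-Reasoning
      V = allFin n
      pair : ∀ v w → ind (adjacent es v w) ≤ ∑ es (λ e → inc e v * inc e w)
      pair v w = begin
        ind (adjacent es v w)                          ≡⟨ ind-∧ (not (does (v ≟ᶠ w))) _ ⟩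
        ind (not (does (v ≟ᶠ w))) * ind (any (λ e → lookup e v ∧ lookup e w) es)
          ≤⟨ *-mono-≤ (ind≤1 (not (does (v ≟ᶠ w)))) (ind-any≤ _ es) ⟩
        1 * count (λ e → lookup e v ∧ lookup e w) es   ≡⟨ *-identityˡ _ ⟩
        count (λ e → lookup e v ∧ lookup e w) es
          ≡⟨ ∑-cong es (λ e → ind-∧ (lookup e v) (lookup e w)) ⟩
        ∑ es (λ e → inc e v * inc e w)                 ∎
      square : ∀ e → e ∈ es → ∑ V (λ v → ∑ V (λ w → inc e v * inc e w)) ≤ k * k
      square e e∈ = ≤-reflexive (trans (∑-cong V (λ v → trans (∑-*ˡ V (inc e v) (inc e))
        (trans (cong (inc e v *_) (∑-inc e∈)) (*-comm (inc e v) k))))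
        (trans (∑-*ˡ V k (inc e)) (cong (k *_) (∑-inc e∈))))

adjacent-irrefl : ∀ (es : List (Subset n)) {v} → ¬ T (adjacent es v v)
adjacent-irrefl es {v} a with v ≟ᶠ v
... | no v≢v = ⊥-elim (v≢v refl)

adjacent-sym : ∀ (es : List (Subset n)) {v w} → T (adjacent es v w) → T (adjacent es w v)
adjacent-sym es {v} {w} a with v ≟ᶠ w | w ≟ᶠ v
... | no _   | no _     = subst T (any-cong es) a
  where
    any-cong : ∀ es → any (λ e → lookup e v ∧ lookup e w) es ≡ any (λ e → lookup e w ∧ lookup e v) es
    any-cong []       = refl
    any-cong (e ∷ es) = cong₂ _∨_ (∧-comm (lookup e v) (lookup e w)) (any-cong es)
... | no v≢w | yes refl = ⊥-elim (v≢w refl)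

adjacent⁺ : ∀ {es : List (Subset n)} {e v w} → e ∈ es → v ∈ˢ e → w ∈ˢ e → v ≢ w → T (adjacent es v w)
adjacent⁺ {es = es} {v = v} {w} e∈ v∈ w∈ v≢w with v ≟ᶠ w
... | yes v≡w = ⊥-elim (v≢w v≡w)
... | no _    = any⁺ (λ e → lookup e v ∧ lookup e w)
                  (lose e∈ (Equivalence.from T-∧ (∈⇒T-lookup v∈ , ∈⇒T-lookup w∈)))

-- s v is the position of v in its colour class.
record RainbowPlacement {k : ℕ} (H : Hypergraph k) (K : ℕ) : Set where
  open Hypergraph H
  field
    κ        : Fin order → ℕ
    s        : Fin order → ℕ
    κ<       : ∀ v → κ v < K
    s≤       : ∀ v → s v ≤ capacity K (κ v)
    distinct : ∀ {v w} → κ v ≡ κ w → s v ≡ s w → v ≡ w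
    rainbow  : ∀ {e v w} → e ∈ edges → v ∈ˢ e → w ∈ˢ e → κ v ≡ κ w → v ≡ w

-- The number of classes comes from `D = m * (k * k)`, which bounds both the order and the degree
-- sum of the shadow: `9 * D ≤ 9 * (σ * σ) * (k * k) = K * K` for `K = 3 * k * σ`.
rainbow-placement : ∀ {k m} (H : Hypergraph k) → 1 ≤ k → size H ≡ m → NoIsolatedVertices H →
                    ∀ σ → m ≤ σ * σ → RainbowPlacement H (3 * k * σ)
rainbow-placement {k} {m} H 1≤k size≡m covered σ m≤σ² = build
  (place-all order (allFin order) (length-allFin order) order≤D (Unique.allFin⁺ order) (Sh.shadow-degree-sum))
  where
    open Hypergraph H
    module Sh = Shadow edges uniform size≡m
    D = m * (k * k)
    K = 3 * k * σ
    9D≤K² : 9 * D ≤ K * K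
    9D≤K² = ≤-trans (*-monoʳ-≤ 9 (*-monoˡ-≤ (k * k) m≤σ²)) (≤-reflexive (rearrange σ k))
      where
        rearrange : ∀ σ k → 9 * (σ * σ * (k * k)) ≡ 3 * k * σ * (3 * k * σ)
        rearrange = solve-∀
    open Placement _≟ᶠ_ (adjacent edges) (λ {v w} → adjacent-sym edges {v} {w})
      (λ {v} a → adjacent-irrefl edges {v} a) D K 9D≤K²
    order≤D : order ≤ D
    order≤D = ≤-trans (Sh.order≤ covered) (*-monoʳ-≤ m (m≤m*n k k {{>-nonZero 1≤k}}))
    build : ∃ (Placed (allFin order)) → RainbowPlacement H K
    build (φ , P) = record
      { κ = proj₁ ∘ φ ; s = proj₂ ∘ φ
      ; κ< = λ v → colour< (∈-allFin v) ; s≤ = λ v → place≤ (∈-allFin v)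
      ; distinct = dist ; rainbow = rain }
      where
        open Placed P using (colour<; place≤; proper)
        dist : ∀ {v w} → proj₁ (φ v) ≡ proj₁ (φ w) → proj₂ (φ v) ≡ proj₂ (φ w) → v ≡ w
        dist {v} {w} κ≡ s≡ = decidable-stable (v ≟ᶠ w) λ v≢w →
          Placed.distinct P (∈-allFin v) (∈-allFin w) v≢w (cong₂ _,_ κ≡ s≡)
        rain : ∀ {e v w} → e ∈ edges → v ∈ˢ e → w ∈ˢ e → proj₁ (φ v) ≡ proj₁ (φ w) → v ≡ w
        rain {e} {v} {w} e∈ v∈ w∈ κ≡ = decidable-stable (v ≟ᶠ w) λ v≢w →
          proper (∈-allFin v) (∈-allFin w) (adjacent⁺ e∈ v∈ w∈ v≢w) κ≡

does≡true⇒ : (a? : Dec A) → does a? ≡ true → A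
does≡true⇒ (yes a) _ = a

-- Subsets of Fin N and duplicate-free lists

module _ {N : ℕ} where
  open DecMembership (_≟ᶠ_ {N}) using () renaming (_∈?_ to _∈ˡ?_)

  fromList : List (Fin N) → Subset N
  fromList ys = Vec.tabulate (λ i → does (i ∈ˡ? ys))

  lookup-fromList : ∀ ys i → Vec.lookup (fromList ys) i ≡ does (i ∈ˡ? ys)
  lookup-fromList ys i = lookup∘tabulate (λ i → does (i ∈ˡ? ys)) i

  ∈-fromList⁺ : ∀ ys {i} → i ∈ ys → i ∈ˢ fromList ys
  ∈-fromList⁺ ys {i} i∈ = lookup⇒[]= i (fromList ys)
    (trans (lookup-fromList ys i) (dec-true (i ∈ˡ? ys) i∈))

  ∈-fromList⁻ : ∀ ys {i} → i ∈ˢ fromList ys → i ∈ ys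
  ∈-fromList⁻ ys {i} i∈ = does≡true⇒ (i ∈ˡ? ys)
    (trans (sym (lookup-fromList ys i)) ([]=⇒lookup i∈))

  elements : Subset N → List (Fin N)
  elements e = filter (T? ∘ Vec.lookup e) (allFin N)

  ∈-elements⁺ : ∀ e {v} → v ∈ˢ e → v ∈ elements e
  ∈-elements⁺ e {v} v∈ = ∈-filter⁺ (T? ∘ Vec.lookup e) (∈-allFin v) (∈⇒T-lookup v∈)

  ∈-elements⁻ : ∀ e {v} → v ∈ elements e → v ∈ˢ e
  ∈-elements⁻ e {v} v∈ = lookup⇒[]= v e
    (Equivalence.to T-≡ (proj₂ (∈-filter⁻ (T? ∘ Vec.lookup e) {xs = allFin N} v∈)))

  elements-unique : ∀ e → Unique (elements e)
  elements-unique e = Unique.filter⁺ (T? ∘ Vec.lookup e) (Unique.allFin⁺ N)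

  length-elements : ∀ e → length (elements e) ≡ card e
  length-elements e = trans (length-filter≡count (T? ∘ Vec.lookup e) (allFin N)) (count-lookup≡card e)

  length-elements-fromList : ∀ {ys} → Unique ys → length (elements (fromList ys)) ≡ length ys
  length-elements-fromList {ys} u = ≤-antisym
    (included (elements-unique (fromList ys)) (∈-fromList⁻ ys ∘ ∈-elements⁻ (fromList ys)))
    (included u (∈-elements⁺ (fromList ys) ∘ ∈-fromList⁺ ys))
    where
      open DecMembership (_≟ᶠ_ {N}) using () renaming (_∉?_ to _∉ˡ?_)
      included : ∀ {xs ys : List (Fin N)} → Unique xs → (∀ {x} → x ∈ xs → x ∈ ys) → length xs ≤ length ys
      included {xs} {ys} u sub = ≤-trans (subst (λ zs → length xs ≤ length ys + length zs)
        (filter-none (_∉ˡ? ys) (All.tabulate λ x∈ x∉ → x∉ (sub x∈)))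
          (length≤length+outside _≟ᶠ_ xs ys u)) (≤-reflexive (+-identityʳ _))

  card-fromList : ∀ {ys} → Unique ys → card (fromList ys) ≡ length ys
  card-fromList {ys} u = trans (sym (length-elements (fromList ys))) (length-elements-fromList u)

-- Copies of the hypergraph inside the chosen parts

lookup-unique-injective : ∀ {xs : List A} → Unique xs → ∀ i j → List.lookup xs i ≡ List.lookup xs j → i ≡ j
lookup-unique-injective (_  ∷ _) zero    zero    eq = refl
lookup-unique-injective (x∉ ∷ _) zero    (suc j) eq = ⊥-elim (All.lookup x∉ (∈-lookup j) eq)
lookup-unique-injective (x∉ ∷ _) (suc i) zero    eq = ⊥-elim (All.lookup x∉ (∈-lookup i) (sym eq))
lookup-unique-injective (_  ∷ u) (suc i) (suc j) eq = cong suc (lookup-unique-injective u i j eq)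

embed-injective : ∀ {l R} (θ : l ↪ R) {i j} → embed θ i ≡ embed θ j → i ≡ j
embed-injective (keep θ) {zero}  {zero}  eq = refl
embed-injective (keep θ) {suc i} {suc j} eq = cong suc (embed-injective θ (sucᶠ-injective eq))
embed-injective (skip θ)                 eq = embed-injective θ (sucᶠ-injective eq)

-- Ramsey's theorem delivers the `K` parts as a sublist of `allFin R`, whereas `blow-up` recurses on
-- a thinning; this translates one into the other.
sublist⇒thinning : ∀ {l R} (f : Fin R → A) {xs} → xs ⊆ tabulate f → length xs ≡ l →
                   ∃ λ (θ : l ↪ R) → xs ≡ tabulate (f ∘ embed θ)
sublist⇒thinning {R = zero}  f []         refl = done , refl
sublist⇒thinning {R = suc R} f (_ ∷ʳ τ)   eq   with sublist⇒thinning (f ∘ suc) τ eq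
... | θ , refl = skip θ , refl
sublist⇒thinning {R = suc R} f (refl ∷ τ) refl with sublist⇒thinning (f ∘ suc) τ refl
... | θ , eq = keep θ , cong (f zero ∷_) eq

-- The part of index i consists of the vertices combine i w.
transversal : ∀ {M R} → Vec (Fin M) R → List (Fin R) → List (Fin (R * M))
transversal x is = map (λ i → combine i (Vec.lookup x i)) is

-- The dummy colour is used for lists that do not form an edge.
edge-colour : ∀ {k N q} → 0 < q → Colouring k N q → Subset N → Fin q
edge-colour {k} 0<q χ e with card e ≟ k
... | yes p = χ (e , p)
... | no  _ = fromℕ< 0<q

edge-colour-edge : ∀ {k N q} (0<q : 0 < q) (χ : Colouring k N q) (e : KEdge k N) →
                   edge-colour 0<q χ (proj₁ e) ≡ χ e
edge-colour-edge {k} 0<q χ (e , p) with card e ≟ k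
... | yes p′ = cong (λ p → χ (e , p)) (≡-irrelevant p′ p)
... | no  ¬p = ⊥-elim (¬p p)

module Embedding {k l R M q : ℕ} (H : Hypergraph k) (0<q : 0 < q) (χ : Colouring k (R * M) q) (c : Fin q)
  (θ : l ↪ R) (U : Fin R → List (Fin M)) (U-unique : ∀ i → Unique (U i)) (U-nonempty : ∀ i → 0 < length (U i))
  (mono : ∀ x → (∀ i → Vec.lookup x i ∈ U i) → ∀ {is} → is ⊆ tabulate (embed θ) → length is ≡ k →
          edge-colour 0<q χ (fromList (transversal x is)) ≡ c)
  (κ : Fin (Hypergraph.order H) → Fin l) (s : ∀ v → Fin (length (U (embed θ (κ v)))))
  (distinct : ∀ {v w} → κ v ≡ κ w → toℕ (s v) ≡ toℕ (s w) → v ≡ w)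
  (rainbow : ∀ {e v w} → e ∈ Hypergraph.edges H → v ∈ˢ e → w ∈ˢ e → κ v ≡ κ w → v ≡ w)
  where

  open Hypergraph H using (order; edges; uniform)

  private
    ι : Fin order → Fin R
    ι v = embed θ (κ v)

    u : Fin order → Fin M
    u v = List.lookup (U (ι v)) (s v)

    f : Fin order → Fin (R * M)
    f v = combine (ι v) (u v)

    same-place : ∀ {i j} → i ≡ j → ∀ a b → List.lookup (U i) a ≡ List.lookup (U j) b → toℕ a ≡ toℕ b
    same-place {i} refl a b eq = cong toℕ (lookup-unique-injective (U-unique i) a b eq)

    f-injective : Injective _≡_ _≡_ f
    f-injective {v} {w} eq = let ι≡ , u≡ = combine-injective (ι v) (u v) (ι w) (u w) eq
      in distinct (embed-injective θ ι≡) (same-place ι≡ (s v) (s w) u≡)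

    first : ∀ i → ∃ (_∈ U i)
    first i with U i | U-nonempty i
    ... | y ∷ _ | _ = y , here refl

  module _ {e : Subset order} (e∈ : e ∈ edges) where
    private
      vs = elements e

      at? : ∀ i → Dec (Any (λ v → ι v ≡ i) vs)
      at? i = Any.any? (λ v → ι v ≟ᶠ i) vs

      -- The colouring is rainbow on `e`, so at most one vertex of `e` lands in part `i`. A single
      -- transversal `x` therefore passes through the images of all vertices of `e`; parts that `e`
      -- misses get an arbitrary member of `U i`.
      choice : ∀ i → ∃ λ w → w ∈ U i × (∀ {v} → v ∈ vs → ι v ≡ i → w ≡ u v)
      choice i with at? i
      ... | no  none = let w , w∈ = first i in w , w∈ , λ v∈ eq → ⊥-elim (none (lose v∈ eq))
      ... | yes some with find some
      ...   | v , v∈ , refl = u v , ∈-lookup (s v) , λ w∈ eq →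
        cong u (rainbow e∈ (∈-elements⁻ e v∈) (∈-elements⁻ e w∈) (sym (embed-injective θ eq)))

      x : Vec (Fin M) R
      x = Vec.tabulate (proj₁ ∘ choice)

      lookup-x : ∀ i → Vec.lookup x i ≡ proj₁ (choice i)
      lookup-x = lookup∘tabulate (proj₁ ∘ choice)

      x∈U : ∀ i → Vec.lookup x i ∈ U i
      x∈U i = subst (_∈ U i) (sym (lookup-x i)) (proj₁ (proj₂ (choice i)))

      x-ι : ∀ {v} → v ∈ vs → Vec.lookup x (ι v) ≡ u v
      x-ι v∈ = trans (lookup-x _) (proj₂ (proj₂ (choice _)) v∈ refl)

      is : List (Fin R)
      is = filter at? (tabulate (embed θ))

      is-unique : Unique is
      is-unique = Unique.filter⁺ at? (Unique.tabulate⁺ (embed-injective θ))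

      image : Subset (R * M)
      image = fromList (map f vs)

      card-image : card image ≡ k
      card-image = trans (card-fromList (Unique.map⁺ f-injective (elements-unique e)))
        (trans (length-map f vs) (trans (length-elements e) (All.lookup uniform e∈)))

      to : ∀ {w} → w ∈ transversal x is → w ∈ map f vs
      to w∈ with ∈-map⁻ (λ i → combine i (Vec.lookup x i)) w∈
      ... | i , i∈ , refl with find (proj₂ (∈-filter⁻ at? {xs = tabulate (embed θ)} i∈))
      ...   | v , v∈ , refl = subst (_∈ map f vs) (cong (combine (ι v)) (sym (x-ι v∈))) (∈-map⁺ f v∈)

      from : ∀ {w} → w ∈ map f vs → w ∈ transversal x is
      from w∈ with ∈-map⁻ f w∈
      ... | v , v∈ , refl = subst (_∈ transversal x is) (cong (combine (ι v)) (x-ι v∈))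
        (∈-map⁺ (λ i → combine i (Vec.lookup x i))
          (∈-filter⁺ at? (∈-tabulate⁺ (κ v)) (lose v∈ refl)))

      transversal≡image : fromList (transversal x is) ≡ image
      transversal≡image = ⊆-antisym 
        (∈-fromList⁺ (map f vs) ∘ to ∘ ∈-fromList⁻ (transversal x is))
        (∈-fromList⁺ (transversal x is) ∘ from ∘ ∈-fromList⁻ (map f vs))

      -- The length is read off from cardinalities: the transversal along `is` is duplicate-free and
      -- spans the same subset as the image of `e`, which has `k` elements.
      length-is : length is ≡ k
      length-is = trans (sym (trans (card-fromList transversal-unique) (length-map _ is)))
        (trans (cong card transversal≡image) card-image)
        where
          transversal-unique : Unique (transversal x is)
          transversal-unique = Unique.map⁺ (λ {i} {j} eq → proj₁ (combine-injective i _ j _ eq)) is-unique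

    embedded-edge : ∃ λ (e′ : KEdge k (R * M)) → IsImage f e (proj₁ e′) × χ e′ ≡ c
    embedded-edge = (image , card-image) , (λ w → mk⇔ (preimage ∘ ∈-fromList⁻ (map f vs)) ∈image) ,
      trans (sym (edge-colour-edge 0<q χ (image , card-image)))
        (trans (cong (edge-colour 0<q χ) (sym transversal≡image))
          (mono x x∈U (filter-⊆ at? _) length-is))
      where
        preimage : ∀ {w} → w ∈ map f vs → ∃ λ v → v ∈ˢ e × f v ≡ w
        preimage w∈ with ∈-map⁻ f w∈
        ... | v , v∈ , refl = v , ∈-elements⁻ e v∈ , refl
        ∈image : ∀ {w} → (∃ λ v → v ∈ˢ e × f v ≡ w) → w ∈ˢ image
        ∈image (v , v∈ , refl) = ∈-fromList⁺ (map f vs) (∈-map⁺ f (∈-elements⁺ e v∈))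

  copy : MonochromaticCopy H χ
  copy = f , c , f-injective , λ e → embedded-edge

-- A monochromatic copy in every colouring of `R` parts of size `M`

capacities : ∀ K → Vec ℕ K
capacities K = Vec.tabulate (capacity K ∘ toℕ)

module _ {q : ℕ} (0<q : 0 < q) (j K R M : ℕ) (ramsey≤R : ramsey q j K ≤ R)
  (large : (suc q * R ^ K) ^ weight (capacities K) ≤ M) (0<R : 0 < R) where

  private
    k : ℕ
    k = suc j
    -- `q * R ^ K` labels would do for the count; `suc q` ensures `2 ≤ D`, which `blow-up` needs,
    -- even when `q` and `R` are 1.
    D = suc q * R ^ K

    2≤D : 2 ≤ D
    2≤D = *-mono-≤ (s≤s 0<q) (m^n>0 R {{>-nonZero 0<R}} K)

    0<M : 0 < M
    0<M = ≤-trans (m^n>0 D {{>-nonZero (≤-trans (s≤s z≤n) 2≤D)}} (weight (capacities K))) large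

  module _ (χ : Colouring k (R * M) q) where
    private
      χ* : Vec (Fin M) R → List (Fin R) → Fin q
      χ* x is = edge-colour 0<q χ (fromList (transversal x is))

      monochromatic : List (Fin R) × Fin q → Vec (Fin M) R → Bool
      monochromatic (L , c) x = all (λ is → does (χ* x is ≟ᶠ c)) (combs k L)

      labels : List (List (Fin R) × Fin q)
      labels = cartesianProduct (combs K (allFin R)) (allFin q)

      labels≤ : length labels ≤ D
      labels≤ = begin
        length labels                           ≡⟨ length-product _,_ (combs K (allFin R)) (allFin q) ⟩
        length (combs K (allFin R)) * length (allFin q)
          ≤⟨ *-mono-≤ (length-combs K (allFin R)) (≤-trans (≤-reflexive (length-allFin q)) (n≤1+n q)) ⟩
        length (allFin R) ^ K * suc q           ≡⟨ cong (λ r → r ^ K * suc q) (length-allFin R) ⟩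
        R ^ K * suc q                           ≡⟨ *-comm (R ^ K) (suc q) ⟩
        D                                       ∎
        where open ≤-Reasoning

      ramsey-label : ∀ x → ∃ λ λc → λc ∈ labels × T (monochromatic λc x)
      ramsey-label x with ramsey-list 0<q j K (χ* x) (allFin R)
                            (≤-trans ramsey≤R (≤-reflexive (sym (length-allFin R))))
      ... | L , c , L⊆ , refl , hom = (L , c) , ∈-cartesianProduct⁺ (∈-combs⁺ L⊆) (∈-allFin c) ,
        all⁻ _ (All.tabulate λ {is} is∈ → let is⊆ , len = ∈-combs⁻ k L is∈ in
          Equivalence.from T-≡ (dec-true (χ* x is ≟ᶠ c) (hom is⊆ len)))

      xs = vecs M R

      popular : ∃ λ λc → λc ∈ labels × length xs ≤ D * count (monochromatic λc) xs
      popular = ≤-average labels (λ λc → D * count (monochromatic λc) xs) (length xs) nonempty (begin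
        length labels * length xs       ≤⟨ *-monoˡ-≤ (length xs) labels≤ ⟩
        D * length xs                   ≡⟨ cong (D *_) (*-identityʳ (length xs)) ⟨
        D * (length xs * 1)             ≤⟨ *-monoʳ-≤ D (∑-bounded-below xs _ 1 (λ x _ → labelled x)) ⟩
        D * ∑ xs (λ x → ∑ labels (λ λc → ind (monochromatic λc x))) ≡⟨ cong (D *_) (∑-swap xs labels _) ⟩
        D * ∑ labels (λ λc → count (monochromatic λc) xs) ≡⟨ ∑-*ˡ labels D _ ⟨
        ∑ labels (λ λc → D * count (monochromatic λc) xs) ∎)
        where
          open ≤-Reasoning
          labelled : ∀ x → 1 ≤ ∑ labels (λ λc → ind (monochromatic λc x))
          labelled x with ramsey-label x
          ... | λc , λc∈ , t = ≤-trans (≤-reflexive (cong ind (sym (Equivalence.to T-≡ t))))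
            (term≤∑ (λ λc → ind (monochromatic λc x)) λc∈)
          ∈⇒nonempty : ∀ {A : Set} {xs : List A} {x} → x ∈ xs → 0 < length xs
          ∈⇒nonempty {xs = _ ∷ _} _ = s≤s z≤n
          nonempty : 0 < length labels
          nonempty = ∈⇒nonempty (proj₁ (proj₂ (ramsey-label (Vec.replicate R (fromℕ< 0<M)))))

      use-thinning : ∀ c (θ : K ↪ R) →
        Blow-up θ (capacities K) (monochromatic (List.tabulate (embed θ) , c)) → ∀ {H : Hypergraph k} →
        RainbowPlacement H K → MonochromaticCopy H χ
      use-thinning c θ (U , unique , nonempty , big , hit) {H} P =
        Embedding.copy H 0<q χ c θ U unique nonempty mono κᶠ (λ v → fromℕ< (sᶠ< v))
          (λ {v} {w} κ≡ s≡ → distinct (κ-cong κ≡)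
            (trans (sym (toℕ-fromℕ< (sᶠ< v))) (trans s≡ (toℕ-fromℕ< (sᶠ< w)))))
          (λ e∈ v∈ w∈ κ≡ → rainbow e∈ v∈ w∈ (κ-cong κ≡))
        where
          open RainbowPlacement P
          open Hypergraph H using (order)
          κᶠ : Fin order → Fin K
          κᶠ v = fromℕ< (κ< v)
          κ-cong : ∀ {v w} → κᶠ v ≡ κᶠ w → κ v ≡ κ w
          κ-cong {v} {w} eq = trans (sym (toℕ-fromℕ< (κ< v))) (trans (cong toℕ eq) (toℕ-fromℕ< (κ< w)))
          sᶠ< : ∀ v → s v < length (U (embed θ (κᶠ v)))
          sᶠ< v = ≤-<-trans (≤-trans (s≤ v) (≤-reflexive (sym
            (trans (lookup∘tabulate (capacity K ∘ toℕ) (κᶠ v)) (cong (capacity K) (toℕ-fromℕ< (κ< v)))))))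
            (big (κᶠ v))
          mono : ∀ x → (∀ i → Vec.lookup x i ∈ U i) → ∀ {is} → is ⊆ List.tabulate (embed θ) →
                 length is ≡ k → χ* x is ≡ c
          mono x x∈ {is} is⊆ len = does≡true⇒ (χ* x is ≟ᶠ c) (Equivalence.to T-≡
            (All.lookup (all⁺ _ (combs k (List.tabulate (embed θ))) (hit x x∈))
              (subst (λ l → is ∈ combs l (List.tabulate (embed θ))) len (∈-combs⁺ is⊆))))

      use-label : (∃ λ λc → λc ∈ labels × length xs ≤ D * count (monochromatic λc) xs) →
        ∀ {H : Hypergraph k} → RainbowPlacement H K → MonochromaticCopy H χ
      use-label ((L , c) , λc∈ , dense)
        with ∈-combs⁻ K (allFin R) (proj₁ (∈-cartesianProduct⁻ (combs K (allFin R)) (allFin q) λc∈))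
      ... | L⊆ , len with sublist⇒thinning id L⊆ len
      ... | θ , refl = use-thinning c θ (blow-up θ (capacities K) D 2≤D _ dense large)

    monochromatic-copy : ∀ {H : Hypergraph k} → RainbowPlacement H K → MonochromaticCopy H χ
    monochromatic-copy = use-label popular

-- Decidability of Arrows and existence of the Ramsey number

module _ {m n : ℕ} {P : (Fin n → Fin m) → Set} (P? : ∀ f → Dec (P f))
  (resp : ∀ {f g} → f ≗ g → P f → P g) where

  -- Functions are searched through their codes. Decoding returns a function that agrees with the
  -- original only pointwise, so `P` has to respect pointwise equality.
  any-function? : Dec (∃ P)
  any-function? = map′ (λ (i , p) → finToFun i , p)
    (λ (f , p) → funToFin f , resp (sym ∘ finToFun-funToFin f) p)
    (any? (P? ∘ finToFun))

  all-functions? : Dec (∀ f → P f)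
  all-functions? = map′ (λ p f → resp (finToFun-funToFin f) (p (funToFin f)))
    (λ p i → p (finToFun i)) (all? (P? ∘ finToFun))

encode : ∀ {N} → Subset N → Fin (2 ^ N)
encode e = funToFin (λ i → if Vec.lookup e i then suc zero else zero)

decode : ∀ {N} → Fin (2 ^ N) → Subset N
decode c = Vec.tabulate (λ i → does (finToFun c i ≟ᶠ suc zero))

decode-encode : ∀ {N} (e : Subset N) → decode (encode e) ≡ e
decode-encode e = trans (tabulate-cong λ i → trans
    (cong (λ b → does (b ≟ᶠ suc zero)) (finToFun-funToFin _ i)) (bit (Vec.lookup e i)))
  (tabulate∘lookup e)
  where
    bit : ∀ b → does ((if b then suc zero else zero) ≟ᶠ suc {1} zero) ≡ b
    bit true  = refl
    bit false = refl

isImage? : ∀ {n N} (f : Fin n → Fin N) e e′ → Dec (IsImage f e e′)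
isImage? f e e′ = all? λ w → map′ (λ (to , from) → mk⇔ to from)
  (λ eq → Equivalence.to eq , Equivalence.from eq)
  ((w ∈ˢ? e′ →-dec hit? w) ×-dec (hit? w →-dec w ∈ˢ? e′))
  where
    hit? : ∀ w → Dec (∃ λ v → v ∈ˢ e × f v ≡ w)
    hit? w = any? λ v → v ∈ˢ? e ×-dec f v ≟ᶠ w

injective? : ∀ {n N} (f : Fin n → Fin N) → Dec (Injective _≡_ _≡_ f)
injective? f = map′ (λ inj {v} {w} → inj v w) (λ inj v w → inj)
  (all? λ v → all? λ w → f v ≟ᶠ f w →-dec v ≟ᶠ w)

any-edge? : ∀ {k N} {P : KEdge k N → Set} → Decidable P → Dec (∃ P)
any-edge? {k} {N} {P} P? = map′ (λ (e , p , h) → (e , p) , h) (λ ((e , p) , h) → e , p , h)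
  (anySubset? with-card?)
  where
    with-card? : ∀ e → Dec (∃ λ (p : card e ≡ k) → P (e , p))
    with-card? e with card e ≟ k
    ... | no  ≢k = no λ (p , _) → ≢k p
    ... | yes p  = map′ (p ,_) (λ (p′ , h) → subst (λ p → P (e , p)) (≡-irrelevant p′ p) h) (P? (e , p))

module _ {k N q : ℕ} (H : Hypergraph k) where
  open Hypergraph H

  copy? : (χ : Colouring k N q) → Dec (MonochromaticCopy H χ)
  copy? χ = any-function? (λ f → any? λ c → injective? f ×-dec
      map′ (λ all e → All.lookup all) (λ all → All.tabulate (all _))
        (All.all? (λ e → any-edge? λ e′ → isImage? f e (proj₁ e′) ×-dec χ e′ ≟ᶠ c) edges))
    λ f≗g (c , inj , copies) → c , (λ {v} {w} eq → inj (trans (f≗g v) (trans eq (sym (f≗g w))))) ,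
      λ e e∈ → let e′ , image , χ≡c = copies e e∈ in e′ , (λ w → mk⇔
        (λ w∈ → let v , v∈ , fv≡w = Equivalence.to (image w) w∈ in v , v∈ , trans (sym (f≗g v)) fv≡w)
        (λ (v , v∈ , gv≡w) → Equivalence.from (image w) (v , v∈ , trans (f≗g v) gv≡w))) , χ≡c

  copy-resp : ∀ {χ χ′ : Colouring k N q} → χ ≗ χ′ → MonochromaticCopy H χ → MonochromaticCopy H χ′
  copy-resp χ≗χ′ (f , c , inj , copies) = f , c , inj , λ e e∈ →
    let e′ , image , χ≡c = copies e e∈ in e′ , image , trans (sym (χ≗χ′ e′)) χ≡c

-- Colourings are replaced by functions on the codes `Fin (2 ^ N)` of all subsets, a finite search
-- space. A colouring extends to such a function by the dummy colour on non-edges, and whether a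
-- copy exists depends only on the values at edges.
arrows? : ∀ {k q} → 0 < q → (H : Hypergraph k) → Decidable (Arrows H q)
arrows? {k} {q} 0<q H N = map′
  (λ all χ → copy-resp H (λ (e , p) → trans (cong (edge-colour 0<q χ) (decode-encode e))
                                     (edge-colour-edge 0<q χ (e , p)))
    (all (edge-colour 0<q χ ∘ decode)))
  (λ all g → all (g ∘ encode ∘ proj₁))
  (all-functions? {P = λ g → MonochromaticCopy H (g ∘ encode ∘ proj₁)}
    (λ g → copy? H (g ∘ encode ∘ proj₁)) (λ g≗h → copy-resp H (g≗h ∘ encode ∘ proj₁)))

-- A Ramsey number is a least value that has to be exhibited. The upward search for it, which the
-- known solution `N` bounds, is why `Arrows` is shown to be decidable.
least : ∀ {P : ℕ → Set} → Decidable P → ∀ {N} → P N → ∃ λ r → P r × (∀ n → P n → r ≤ n)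
least {P} P? {N} pN = search N 0 (+-identityʳ N) λ n _ → z≤n
  where
    search : ∀ fuel i → fuel + i ≡ N → (∀ n → P n → i ≤ n) → ∃ λ r → P r × (∀ n → P n → r ≤ n)
    search zero       i refl below = i , pN , below
    search (suc fuel) i eq   below with P? i
    ... | yes pi = i , pi , below
    ... | no ¬pi = search fuel (suc i) (trans (+-suc fuel i) eq)
                     λ n pn → ≤∧≢⇒< (below n pn) λ { refl → ¬pi pn }

-- Numerical estimates

-- If `σ * σ` falls short of `suc m`, then `σ ≤ σ * σ ≤ m`, so the next square is at most
-- `3 * m + 1`. The constant 4 only has to stay below 9, since `σ / 3` is later compared with the
-- root of `m`.
ceil-sqrt : ∀ m → ∃ λ σ → m ≤ σ * σ × σ * σ ≤ 4 * m
ceil-sqrt zero    = 0 , z≤n , z≤n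
ceil-sqrt (suc m) with ceil-sqrt m
... | σ , m≤ , ≤4m with suc m ≤? σ * σ
...   | yes m<σ² = σ , m<σ² , ≤-trans ≤4m (*-monoʳ-≤ 4 (n≤1+n m))
...   | no  m≮σ² = suc σ , suc≤ , (begin
        suc σ * suc σ           ≡⟨ square σ ⟩
        σ * σ + (2 * σ + 1)     ≤⟨ +-mono-≤ σ²≤m (+-monoˡ-≤ 1 (*-monoʳ-≤ 2 (≤-trans (σ≤σ² σ) σ²≤m))) ⟩
        m + (2 * m + 1)         ≤⟨ m≤m+n _ (m + 3) ⟩
        m + (2 * m + 1) + (m + 3) ≡⟨ collect m ⟩
        4 * suc m               ∎)
  where
    open ≤-Reasoning
    σ²≤m : σ * σ ≤ m
    σ²≤m = ≤-pred (≰⇒> m≮σ²)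
    σ≤σ² : ∀ n → n ≤ n * n
    σ≤σ² zero    = z≤n
    σ≤σ² (suc n) = m≤m*n (suc n) (suc n)
    square : ∀ σ → suc σ * suc σ ≡ σ * σ + (2 * σ + 1)
    square = solve-∀
    collect : ∀ m → m + (2 * m + 1) + (m + 3) ≡ 4 * suc m
    collect = solve-∀
    suc≤ : suc m ≤ suc σ * suc σ
    suc≤ = ≤-trans (s≤s m≤) (≤-trans (≤-reflexive (+-comm 1 (σ * σ)))
      (≤-trans (+-monoʳ-≤ (σ * σ) (m≤n+m 1 (2 * σ))) (≤-reflexive (sym (square σ)))))

^-distribʳ-* : ∀ e m n → (m * n) ^ e ≡ m ^ e * n ^ e
^-distribʳ-* zero    m n = refl
^-distribʳ-* (suc e) m n = trans (cong (m * n *_) (^-distribʳ-* e m n))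
  ([m*n]*[o*p]≡[m*o]*[n*p] m n (m ^ e) (n ^ e))

-- rising a l = (a + 1) ⋯ (a + l)
rising : ℕ → ℕ → ℕ
rising a zero    = 1
rising a (suc l) = suc a * rising (suc a) l

rising-! : ∀ a l → rising a l * a ! ≡ (a + l) !
rising-! a zero    = trans (*-identityˡ _) (cong _! (sym (+-identityʳ a)))
rising-! a (suc l) = begin
  suc a * rising (suc a) l * a !   ≡⟨ cong (_* a !) (*-comm (suc a) (rising (suc a) l)) ⟩
  rising (suc a) l * suc a * a !   ≡⟨ *-assoc (rising (suc a) l) (suc a) (a !) ⟩
  rising (suc a) l * suc a !       ≡⟨ rising-! (suc a) l ⟩
  (suc a + l) !                    ≡⟨ cong _! (sym (+-suc a l)) ⟩
  (a + suc l) !                    ∎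
  where open ≡-Reasoning

^≤rising : ∀ {b} a l → b ≤ a → b ^ l ≤ rising a l
^≤rising a zero    b≤a = ≤-refl
^≤rising a (suc l) b≤a = *-mono-≤ (m≤n⇒m≤1+n b≤a) (^≤rising (suc a) l (m≤n⇒m≤1+n b≤a))

n!>0 : ∀ n → 0 < n !
n!>0 zero    = s≤s z≤n
n!>0 (suc n) = *-mono-< {0} {suc n} {0} {n !} (s≤s z≤n) (n!>0 n)

[2n]!≤4^n*n!² : ∀ n → (n + n) ! ≤ 4 ^ n * (n ! * n !)
[2n]!≤4^n*n!² zero    = ≤-refl
[2n]!≤4^n*n!² (suc n) = begin
  (suc n + suc n) !                              ≡⟨ cong _! (cong suc (+-suc n n)) ⟩
  suc (suc (n + n)) * (suc (n + n) * (n + n) !)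
    ≤⟨ *-mono-≤ (≤-reflexive (even n)) (*-mono-≤ (odd n) ([2n]!≤4^n*n!² n)) ⟩
  2 * suc n * (2 * suc n * (4 ^ n * (n ! * n !))) ≡⟨ rearrange (suc n) (4 ^ n) (n !) ⟩
  4 ^ suc n * (suc n ! * suc n !)                ∎
  where
    open ≤-Reasoning
    even : ∀ n → suc (suc (n + n)) ≡ 2 * suc n
    even = solve-∀
    odd : ∀ n → suc (n + n) ≤ 2 * suc n
    odd n = ≤-trans (n≤1+n _) (≤-reflexive (even n))
    rearrange : ∀ s p f → 2 * s * (2 * s * (p * (f * f))) ≡ 4 * p * (s * f * (s * f))
    rearrange = solve-∀

-- A substitute for Stirling's formula: the factors n+1, ..., 2n of (2n)!/n! are all at least n, and
-- the central binomial coefficient is at most 4^n.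
n^n≤4^n*n! : ∀ n → n ^ n ≤ 4 ^ n * n !
n^n≤4^n*n! n = *-cancelʳ-≤ _ _ (n !) {{>-nonZero (n!>0 n)}} (begin
  n ^ n * n !          ≤⟨ *-monoˡ-≤ (n !) (^≤rising n n ≤-refl) ⟩
  rising n n * n !     ≡⟨ rising-! n n ⟩
  (n + n) !            ≤⟨ [2n]!≤4^n*n!² n ⟩
  4 ^ n * (n ! * n !)  ≡⟨ *-assoc (4 ^ n) (n !) (n !) ⟨
  4 ^ n * n ! * n !    ∎)
  where open ≤-Reasoning

-- The factors are paired off: the square of a+i+1 meets the factor `3 * (2 + g i)` of the weight,
-- and each such product is at most `3 * B`. The offset `a` is there for the induction.
rising*weight≤ : ∀ a l (g : Fin l → ℕ) B → (∀ i → suc (a + toℕ i) * suc (a + toℕ i) * (2 + g i) ≤ B) →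
                 rising a l * rising a l * weight (Vec.tabulate g) ≤ (3 * B) ^ l
rising*weight≤ a zero    g B bound = ≤-refl
rising*weight≤ a (suc l) g B bound = begin
  suc a * r * (suc a * r) * (3 * (2 + g zero) * w)        ≡⟨ rearrange (suc a) r (2 + g zero) w ⟩
  3 * (suc a * suc a * (2 + g zero)) * (r * r * w)        ≤⟨ *-mono-≤ (*-monoʳ-≤ 3 head) tail ⟩
  3 * B * (3 * B) ^ l                                     ∎
  where
    open ≤-Reasoning
    r = rising (suc a) l
    w = weight (Vec.tabulate (g ∘ suc))
    rearrange : ∀ s r c w → s * r * (s * r) * (3 * c * w) ≡ 3 * (s * s * c) * (r * r * w)
    rearrange = solve-∀
    head : suc a * suc a * (2 + g zero) ≤ B
    head = subst (λ x → suc x * suc x * (2 + g zero) ≤ B) (+-identityʳ a) (bound zero)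
    tail : r * r * w ≤ (3 * B) ^ l
    tail = rising*weight≤ (suc a) l (g ∘ suc) B
      (λ i → subst (λ x → suc x * suc x * (2 + g (suc i)) ≤ B) (+-suc a (toℕ i)) (bound (suc i)))

-- 144 is 3 * 3 * 4 * 4: one 3 from `weight`, one from the bound `3 * (K * K)` on each paired
-- factor, and two 4s from comparing the square of `K ^ K` with that of `K !`.
weight-capacities : ∀ K → weight (capacities K) ≤ 144 ^ K
weight-capacities K = *-cancelˡ-≤ (K ! * K !) {{>-nonZero (*-mono-< (n!>0 K) (n!>0 K))}} (begin
  K ! * K ! * w                     ≡⟨ cong (λ f → f * f * w) (sym K!) ⟩
  rising 0 K * rising 0 K * w       ≤⟨ rising*weight≤ 0 K _ (3 * (K * K)) bound ⟩
  (3 * (3 * (K * K))) ^ K           ≡⟨ cong (_^ K) (*-assoc 3 3 (K * K)) ⟨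
  (9 * (K * K)) ^ K
    ≡⟨ trans (^-distribʳ-* K 9 (K * K)) (cong (9 ^ K *_) (^-distribʳ-* K K K)) ⟩
  9 ^ K * (K ^ K * K ^ K)           ≤⟨ *-monoʳ-≤ (9 ^ K) (*-mono-≤ (n^n≤4^n*n! K) (n^n≤4^n*n! K)) ⟩
  9 ^ K * (4 ^ K * K ! * (4 ^ K * K !)) ≡⟨ rearrange (9 ^ K) (4 ^ K) (K !) ⟩
  K ! * K ! * (9 ^ K * (4 ^ K * 4 ^ K))
    ≡⟨ cong (K ! * K ! *_) (trans (^-distribʳ-* K 9 16) (cong (9 ^ K *_) (^-distribʳ-* K 4 4))) ⟨
  K ! * K ! * 144 ^ K               ∎)
  where
    open ≤-Reasoning
    w = weight (capacities K)
    K! : rising 0 K ≡ K !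
    K! = trans (sym (*-identityʳ _)) (rising-! 0 K)
    rearrange : ∀ n f k → n * (f * k * (f * k)) ≡ k * k * (n * (f * f))
    rearrange = solve-∀
    bound : ∀ i → suc (toℕ i) * suc (toℕ i) * (2 + capacity K (toℕ {K} i)) ≤ 3 * (K * K)
    bound i = begin
      j² * (2 + c)            ≡⟨ expand j² c ⟩
      2 * j² + c * j²
        ≤⟨ +-mono-≤ (*-monoʳ-≤ 2 (*-mono-≤ (toℕ<n i) (toℕ<n i))) (m/n*n≤m (K * K) j²) ⟩
      2 * (K * K) + K * K     ≡⟨ collect (K * K) ⟩
      3 * (K * K)             ∎
      where
        j² = suc (toℕ i) * suc (toℕ i)
        c = capacity K (toℕ i)
        expand : ∀ j c → j * (2 + c) ≡ 2 * j + c * j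
        expand = solve-∀
        collect : ∀ x → 2 * x + x ≡ 3 * x
        collect = solve-∀

-- tower h x = tw (h + 1) x
tower : ℕ → ℕ → ℕ
tower zero    x = x
tower (suc h) x = 2 ^ tower h x

x≤tower : ∀ h x → x ≤ tower h x
x≤tower zero    x = ≤-refl
x≤tower (suc h) x = ≤-trans (x≤tower h x) (<⇒≤ (n<2^n _))

-- A constant factor sinks through every level of the tower, because `suc c * 2 ^ y ≤ 2 ^ (c + y) ≤
-- 2 ^ (suc c * y)` once `y` is positive.
*-tower : ∀ h c x → 0 < c → 0 < x → c * tower h x ≤ tower h (c * x)
*-tower zero    c       x 0<c 0<x = ≤-refl
*-tower (suc h) (suc c) x 0<c 0<x = begin
  suc c * 2 ^ y       ≤⟨ *-monoˡ-≤ (2 ^ y) (n<2^n c) ⟩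
  2 ^ c * 2 ^ y       ≡⟨ ^-distribˡ-+-* 2 c y ⟨
  2 ^ (c + y)
    ≤⟨ ^-monoʳ-≤ 2 (≤-trans (≤-reflexive (+-comm c y)) (+-monoʳ-≤ y (m≤m*n c y {{>-nonZero (≤-trans 0<x (x≤tower h x))}}))) ⟩
  2 ^ (suc c * y)     ≤⟨ ^-monoʳ-≤ 2 (*-tower h (suc c) x 0<c 0<x) ⟩
  2 ^ tower h (suc c * x) ∎
  where
    open ≤-Reasoning
    y = tower h x

suc-q^≤ : ∀ q e → suc q ^ e ≤ 2 ^ (q * e)
suc-q^≤ q e = ≤-trans (^-monoˡ-≤ e (n<2^n q)) (≤-reflexive (^-*-assoc 2 q e))

≤2^* : ∀ q {y} → 0 < y → q ≤ 2 ^ (q * y)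
≤2^* q 0<y = ≤-trans (<⇒≤ (n<2^n q)) (^-monoʳ-≤ 2 (m≤m*n q _ {{>-nonZero 0<y}}))

-- The uniformity is `h + 3`. The left side is the number of vertices used: `Ram` parts of size
-- `D ^ W` with `D = suc q * Ram ^ K` and `K = κ * σ`. `W` will be the weight of the capacities.
OrderBound : ℕ → ℕ → ℕ → ℕ → Set
OrderBound q κ h C = ∀ σ W → 0 < σ → W ≤ 144 ^ (κ * σ) →
  let Ram = ramsey q (suc (suc h)) (κ * σ) in Ram * (suc q * Ram ^ (κ * σ)) ^ W ≤ tower (suc (suc h)) (C * σ)

module _ {q κ : ℕ} (0<q : 0 < q) (0<κ : 0 < κ) where

  RamseyBound : ℕ → Set
  RamseyBound h = ∃ λ c → 0 < c × (∀ σ → 0 < σ → ramsey q (suc h) (κ * σ) ≤ 2 ^ tower h (c * σ))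

  -- Here the uniformity is `h + 2`. If the previous bound is `2 ^ y`, the exponent of the next one
  -- is at most `2 ^ ((q + h + 2) * y)`, and `*-tower` moves the constant factor into the argument
  -- of the tower `y`.
  ramsey-bound : ∀ h → RamseyBound h
  ramsey-bound zero = q * (q * κ) , *-mono-< 0<q (*-mono-< 0<q 0<κ) , λ σ _ →
    ≤-trans (suc-q^≤ q _) (≤-reflexive (cong (2 ^_) (rearrange q κ σ)))
    where
      rearrange : ∀ q κ σ → q * (q * (κ * σ) * 1) ≡ q * (q * κ) * σ
      rearrange = solve-∀
  ramsey-bound (suc h) with ramsey-bound h
  ... | c , 0<c , bound = (q + suc (suc h)) * c , *-mono-< 0<q+ 0<c , λ σ 0<σ →
      ≤-trans (suc-q^≤ q _) (^-monoʳ-≤ 2 (exponent σ 0<σ))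
    where
      0<q+ : 0 < q + suc (suc h)
      0<q+ = ≤-trans 0<q (m≤m+n q _)
      exponent : ∀ σ → 0 < σ → q * ramsey q (suc h) (κ * σ) ^ suc (suc h) ≤ 2 ^ tower h ((q + suc (suc h)) * c * σ)
      exponent σ 0<σ = begin
        q * ramsey q (suc h) (κ * σ) ^ suc (suc h)
          ≤⟨ *-mono-≤ (≤2^* q 0<y) (^-monoˡ-≤ (suc (suc h)) (bound σ 0<σ)) ⟩
        2 ^ (q * y) * (2 ^ y) ^ suc (suc h)
          ≡⟨ cong (2 ^ (q * y) *_) (^-*-assoc 2 y (suc (suc h))) ⟩
        2 ^ (q * y) * 2 ^ (y * suc (suc h))          ≡⟨ ^-distribˡ-+-* 2 (q * y) (y * suc (suc h)) ⟨
        2 ^ (q * y + y * suc (suc h))                ≡⟨ cong (2 ^_) (collect q y (suc (suc h))) ⟩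
        2 ^ ((q + suc (suc h)) * y)                  ≤⟨ ^-monoʳ-≤ 2 (*-tower h _ (c * σ) 0<q+ 0<cσ) ⟩
        2 ^ tower h ((q + suc (suc h)) * (c * σ))
          ≡⟨ cong (λ x → 2 ^ tower h x) (*-assoc (q + suc (suc h)) c σ) ⟨
        2 ^ tower h ((q + suc (suc h)) * c * σ)      ∎
        where
          open ≤-Reasoning
          y = tower h (c * σ)
          0<cσ : 0 < c * σ
          0<cσ = *-mono-< 0<c 0<σ
          0<y : 0 < y
          0<y = ≤-trans 0<cσ (x≤tower h (c * σ))
          collect : ∀ q y j → q * y + y * j ≡ (q + j) * y
          collect = solve-∀

  -- Since `suc q ≤ Ram`, the order is at most `Ram ^ suc (suc K * W)`, whose binary logarithm is at
  -- most `q * S * suc (suc K * W)`. All three factors are at most powers of 2 with exponent a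
  -- constant times `y`: the last one because `K ≤ κ * y`. The constants `q`, `j` and `10 * κ` add
  -- up and sink into the tower.
  order-bound : ∀ h → ∃ (OrderBound q κ h)
  order-bound h with ramsey-bound h
  ... | c , 0<c , bound = (q + j + 10 * κ) * c , main
    where
    j : ℕ
    j = suc (suc h)
    0<C : 0 < q + j + 10 * κ
    0<C = ≤-trans 0<q (≤-trans (m≤m+n q j) (m≤m+n (q + j) (10 * κ)))
    module _ (σ W : ℕ) (0<σ : 0 < σ) (W≤ : W ≤ 144 ^ (κ * σ)) where
      open ≤-Reasoning
      K = κ * σ
      S = ramsey q (suc h) K ^ j
      Ram = suc q ^ S
      y = tower h (c * σ)
      0<cσ : 0 < c * σ
      0<cσ = *-mono-< 0<c 0<σ
      0<K : 0 < K
      0<K = *-mono-< 0<κ 0<σ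
      0<y : 0 < y
      0<y = ≤-trans 0<cσ (x≤tower h (c * σ))
      0<S : 0 < S
      0<S = m^n>0 (ramsey q (suc h) K) {{>-nonZero (m^n>0 (suc q) (ramsey q h K ^ suc h))}} j
      sq≤Ram : suc q ≤ Ram
      sq≤Ram = ≤-trans (≤-reflexive (sym (^-identityʳ (suc q)))) (^-monoʳ-≤ (suc q) 0<S)
      S≤ : S ≤ 2 ^ (y * j)
      S≤ = ≤-trans (^-monoˡ-≤ j (bound σ 0<σ)) (≤-reflexive (^-*-assoc 2 y j))
      -- The 10 is 1 + 8 + 1: from `suc K ≤ 2 ^ K`, from `144 ≤ 2 ^ 8`, and from doubling to absorb
      -- the outer `suc`.
      blow≤ : suc (suc K * W) ≤ 2 ^ (10 * K)
      blow≤ = begin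
        suc (suc K * W)               ≤⟨ s≤s (*-mono-≤ (n<2^n K) (≤-trans W≤ (^-monoˡ-≤ K 144≤2^8))) ⟩
        suc (2 ^ K * (2 ^ 8) ^ K)     ≡⟨ cong (λ x → suc (2 ^ K * x)) (^-*-assoc 2 8 K) ⟩
        suc (2 ^ K * 2 ^ (8 * K))     ≡⟨ cong suc (^-distribˡ-+-* 2 K (8 * K)) ⟨
        suc (2 ^ (9 * K))             ≤⟨ +-mono-≤ (m^n>0 2 (9 * K)) (≤-reflexive (sym (+-identityʳ _))) ⟩
        2 ^ suc (9 * K)               ≤⟨ ^-monoʳ-≤ 2 (+-monoˡ-≤ (9 * K) 0<K) ⟩
        2 ^ (10 * K)                  ∎
        where
          144≤2^8 : 144 ≤ 2 ^ 8
          144≤2^8 = m≤m+n 144 112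
      K≤κy : K ≤ κ * y
      K≤κy = *-monoʳ-≤ κ (≤-trans (m≤n*m σ c {{>-nonZero 0<c}}) (x≤tower h (c * σ)))
      main : Ram * (suc q * Ram ^ K) ^ W ≤ 2 ^ (2 ^ tower h ((q + j + 10 * κ) * c * σ))
      main = begin
        Ram * (suc q * Ram ^ K) ^ W        ≤⟨ *-monoʳ-≤ Ram (^-monoˡ-≤ W (*-monoˡ-≤ (Ram ^ K) sq≤Ram)) ⟩
        Ram * (Ram ^ suc K) ^ W            ≡⟨ cong (Ram *_) (^-*-assoc Ram (suc K) W) ⟩
        Ram ^ suc (suc K * W)            ≤⟨ ^-monoˡ-≤ (suc (suc K * W)) (suc-q^≤ q S) ⟩
        (2 ^ (q * S)) ^ suc (suc K * W) ≡⟨ ^-*-assoc 2 (q * S) _ ⟩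
        2 ^ (q * S * suc (suc K * W))  ≤⟨ ^-monoʳ-≤ 2 exponent ⟩
        2 ^ (2 ^ tower h ((q + j + 10 * κ) * c * σ)) ∎
        where
          collect : ∀ q y j κ → q * y + y * j + 10 * (κ * y) ≡ (q + j + 10 * κ) * y
          collect = solve-∀
          exponent : q * S * suc (suc K * W) ≤ 2 ^ tower h ((q + j + 10 * κ) * c * σ)
          exponent = begin
            q * S * suc (suc K * W)
              ≤⟨ *-mono-≤ (*-mono-≤ (≤2^* q 0<y) S≤) (≤-trans blow≤ (^-monoʳ-≤ 2 (*-monoʳ-≤ 10 K≤κy))) ⟩
            2 ^ (q * y) * 2 ^ (y * j) * 2 ^ (10 * (κ * y))
              ≡⟨ cong (_* 2 ^ (10 * (κ * y))) (^-distribˡ-+-* 2 (q * y) (y * j)) ⟨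
            2 ^ (q * y + y * j) * 2 ^ (10 * (κ * y))
              ≡⟨ ^-distribˡ-+-* 2 (q * y + y * j) (10 * (κ * y)) ⟨
            2 ^ (q * y + y * j + 10 * (κ * y))          ≡⟨ cong (2 ^_) (collect q y j κ) ⟩
            2 ^ ((q + j + 10 * κ) * y)                  ≤⟨ ^-monoʳ-≤ 2 (*-tower h _ (c * σ) 0<C 0<cσ) ⟩
            2 ^ tower h ((q + j + 10 * κ) * (c * σ))
              ≡⟨ cong (λ x → 2 ^ tower h x) (*-assoc (q + j + 10 * κ) c σ) ⟨
            2 ^ tower h ((q + j + 10 * κ) * c * σ)      ∎

-- Membership in the cuts

fromℕ-mono-< : ∀ {m n} → m < n → fromℕ m ℚ.< fromℕ n
fromℕ-mono-< {m} {n} m<n = ℚ.toℚᵘ-cancel-<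
  (ℚᵘ.<-respˡ-≃ (ℚᵘ.≃-sym (toℚᵘ-fromℕ m)) (ℚᵘ.<-respʳ-≃ (ℚᵘ.≃-sym (toℚᵘ-fromℕ n))
    (ℚᵘ.*<* (ℤ.*-monoʳ-<-pos (ℤ.+ 1) (ℤ.+<+ m<n)))))

fromℕ-* : ∀ m n → fromℕ m ℚ.* fromℕ n ≡ fromℕ (m * n)
fromℕ-* m n = ℚ.toℚᵘ-injective (begin
  toℚᵘ (fromℕ m ℚ.* fromℕ n)            ≈⟨ ℚ.toℚᵘ-homo-* (fromℕ m) (fromℕ n) ⟩
  toℚᵘ (fromℕ m) ℚᵘ.* toℚᵘ (fromℕ n)    ≈⟨ ℚᵘ.*-cong (toℚᵘ-fromℕ m) (toℚᵘ-fromℕ n) ⟩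
  mkℚᵘ (ℤ.+ m) 0 ℚᵘ.* mkℚᵘ (ℤ.+ n) 0        ≡⟨ cong (λ i → mkℚᵘ i 0) (ℤ.pos-* m n) ⟨
  mkℚᵘ (ℤ.+ (m * n)) 0                    ≈⟨ toℚᵘ-fromℕ (m * n) ⟨
  toℚᵘ (fromℕ (m * n))                  ∎)
  where open ℚᵘ.≃-Reasoning

fromℕ-^ : ∀ m e → fromℕ m ^ℚ e ≡ fromℕ (m ^ e)
fromℕ-^ m zero    = refl
fromℕ-^ m (suc e) = trans (cong (fromℕ m ℚ.*_) (fromℕ-^ m e)) (fromℕ-* m (m ^ e))

fromℕ<⇒fraction : ∀ {n q} → fromℕ n ℚ.< q → ∃₂ λ a b → q ≡ ℤ.+ a ℚ./ suc b × n * suc b < a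
fromℕ<⇒fraction {n} {q} n<q = cases q (ℚᵘ.<-respˡ-≃ (toℚᵘ-fromℕ n) (ℚ.toℚᵘ-mono-< n<q))
  where
    cases : ∀ q → mkℚᵘ (ℤ.+ n) 0 ℚᵘ.< toℚᵘ q → ∃₂ λ a b → q ≡ ℤ.+ a ℚ./ suc b × n * suc b < a
    cases q@(mkℚ (ℤ.+ a) b _) (ℚᵘ.*<* lt) = a , b , sym (ℚ.↥p/↧p≡p q) , ℤ.drop‿+<+
      (subst₂ ℤ._<_ (sym (ℤ.pos-* n (suc b))) (ℤ.*-identityʳ (ℤ.+ a)) lt)
    cases (mkℚ ℤ.-[1+ a ] b _) (ℚᵘ.*<* lt)
      with () ← subst₂ ℤ._<_ (sym (ℤ.pos-* n (suc b))) (ℤ.*-identityʳ ℤ.-[1+ a ]) lt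

-- Cuts are open, so `n` itself cannot serve as the exponent: equality would hold in place of `<`.
-- Roundedness supplies a larger fraction a/(b+1) in `x`, and n(b+1) < a makes the comparison of
-- powers strict.
exp₂-∋ : ∀ x n → x ∋ fromℕ n → exp₂ x ∋ fromℕ (2 ^ n)
exp₂-∋ x n n∈ with ℝ⁺.rounded x n∈
... | q , n<q , q∈ with fromℕ<⇒fraction {n} n<q
... | a , b , refl , nb<a = a , b , q∈ ,
  subst₂ ℚ._<_ (sym power) (sym (fromℕ-^ 2 a))
    (fromℕ-mono-< {2 ^ (n * suc b)} {2 ^ a} (^-monoʳ-< 2 (s≤s (s≤s z≤n)) nb<a))
  where
    open ≡-Reasoning
    power : (fromℕ (2 ^ n) ℚ.⊔ 0ℚ) ^ℚ suc b ≡ fromℕ (2 ^ (n * suc b))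
    power = begin
      (fromℕ (2 ^ n) ℚ.⊔ 0ℚ) ^ℚ suc b  ≡⟨ cong (_^ℚ suc b) (ℚ.p≥q⇒p⊔q≡p (fromℕ-mono-≤ {0} {2 ^ n} z≤n)) ⟩
      fromℕ (2 ^ n) ^ℚ suc b           ≡⟨ fromℕ-^ (2 ^ n) (suc b) ⟩
      fromℕ ((2 ^ n) ^ suc b)          ≡⟨ cong fromℕ (^-*-assoc 2 n (suc b)) ⟩
      fromℕ (2 ^ (n * suc b))          ∎

tw-∋ : ∀ h {x n} → x ∋ fromℕ n → tw (suc h) x ∋ fromℕ (tower h n)
tw-∋ zero    n∈ = n∈
tw-∋ (suc h) {x} {n} n∈ = exp₂-∋ (tw (suc h) x) (tower h n) (tw-∋ h n∈)

below : ∀ n .{{_ : NonZero n}} → ℝ⁺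
below n = record
  { _∋_     = ℚ._< fromℕ n
  ; ∋0      = fromℕ-mono-< {0} {n} (>-nonZero⁻¹ n)
  ; bounded = fromℕ n , λ p< → p<
  ; lower   = ℚ.≤-<-trans
  ; rounded = λ p< → let q , p<q , q< = ℚ.<-dense p< in q , p<q , q<
  }

-- Abstract, since comparing cuts by unfolding them to normalised fractions is infeasible.
abstract
  scale : ℕ → ℝ⁺
  scale c = below (2 + 3 * c)

  -- σ/3 < √m because σ² ≤ 4m < 9m, and the extra 1 and 2 make the factor 3c and its cut strict.
  scale·√-∋ : ∀ c σ m .{{_ : NonZero m}} → 0 < σ → σ * σ ≤ 4 * m →
         (scale c · √ m) ∋ fromℕ (c * σ)
  scale·√-∋ c σ m 0<σ σ²≤4m = fromℕ (1 + 3 * c) , σ/3 , fromℕ-mono-< {0} {1 + 3 * c} (s≤s z≤n) ,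
    fromℕ-mono-< {1 + 3 * c} {2 + 3 * c} ≤-refl , 0<σ/3 , root , cσ≤
    where
      σ/3 : ℚ
      σ/3 = ℤ.+ σ ℚ./ 3
      toℚᵘ-σ/3 : toℚᵘ σ/3 ℚᵘ.≃ mkℚᵘ (ℤ.+ σ) 2
      toℚᵘ-σ/3 = ℚ.toℚᵘ-fromℚᵘ (mkℚᵘ (ℤ.+ σ) 2)
      0<σ/3 : 0ℚ ℚ.< σ/3
      0<σ/3 = ℚ.toℚᵘ-cancel-< (ℚᵘ.<-respʳ-≃ (ℚᵘ.≃-sym toℚᵘ-σ/3)
        (ℚᵘ.*<* (subst (ℤ.+ 0 ℤ.<_) (sym (ℤ.*-identityʳ (ℤ.+ σ))) (ℤ.+<+ 0<σ))))
      cσ≤ : fromℕ (c * σ) ℚ.≤ fromℕ (1 + 3 * c) ℚ.* σ/3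
      cσ≤ = ℚ.toℚᵘ-cancel-≤ (ℚᵘ.≤-respˡ-≃ (ℚᵘ.≃-sym (toℚᵘ-fromℕ (c * σ)))
        (ℚᵘ.≤-respʳ-≃ (ℚᵘ.≃-sym (ℚᵘ.≃-trans (ℚ.toℚᵘ-homo-* (fromℕ (1 + 3 * c)) σ/3)
            (ℚᵘ.*-cong (toℚᵘ-fromℕ (1 + 3 * c)) toℚᵘ-σ/3)))
          (ℚᵘ.*≤* (subst₂ ℤ._≤_ (ℤ.pos-* (c * σ) 3)
            (trans (ℤ.pos-* (1 + 3 * c) σ) (sym (ℤ.*-identityʳ _)))
            (ℤ.+≤+ (≤-trans (≤-reflexive (rearrange c σ)) (*-monoˡ-≤ σ (n≤1+n (3 * c)))))))))
        where
          rearrange : ∀ c σ → c * σ * 3 ≡ 3 * c * σ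
          rearrange = solve-∀
      root : (σ/3 ℚ.⊔ 0ℚ) ^ℚ 2 ℚ.< fromℕ m
      root = subst (ℚ._< fromℕ m) (sym (trans (cong (_^ℚ 2) (ℚ.p≥q⇒p⊔q≡p (ℚ.<⇒≤ 0<σ/3)))
          (cong (σ/3 ℚ.*_) (ℚ.*-identityʳ σ/3))))
        (ℚ.toℚᵘ-cancel-< (ℚᵘ.<-respʳ-≃ (ℚᵘ.≃-sym (toℚᵘ-fromℕ m))
          (ℚᵘ.<-respˡ-≃ (ℚᵘ.≃-sym (ℚᵘ.≃-trans (ℚ.toℚᵘ-homo-* σ/3 σ/3) (ℚᵘ.*-cong toℚᵘ-σ/3 toℚᵘ-σ/3)))
            (ℚᵘ.*<* (subst₂ ℤ._<_ (trans (ℤ.pos-* σ σ) (sym (ℤ.*-identityʳ _))) (ℤ.pos-* m 9)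
              (ℤ.+<+ (≤-<-trans σ²≤4m (≤-trans (*-monoˡ-< m {{>-nonZero (>-nonZero⁻¹ m)}} {4} {9} (m≤m+n 5 4))
                (≤-reflexive (*-comm 9 m))))))))))

-- From the bound on the order to the Ramsey number and the real tower

ramsey-number : ∀ {k q} → 0 < q → (H : Hypergraph k) → ∀ {N} → Arrows H q N →
                ∃ λ r → IsRamseyNumber H q r × r ≤ N
ramsey-number 0<q H {N} arrows =
  let r , arr , minimal = least (arrows? 0<q H) arrows in r , (arr , minimal) , minimal N arrows

≤⇒≤ℝ : ∀ {r n} x → r ≤ n → x ∋ fromℕ n → r ≤ℝ x
≤⇒≤ℝ {r} {n} x r≤n n∈ p p<r = ℝ⁺.lower x (ℚ.<⇒≤ (ℚ.<-≤-trans p<r (fromℕ-mono-≤ {r} {n} r≤n))) n∈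

≤tower⇒≤ℝtw : ∀ h x {n r} → x ∋ fromℕ n → r ≤ tower h n → r ≤ℝ tw (suc h) x
≤tower⇒≤ℝtw h x {n} {r} n∈ r≤ = ≤⇒≤ℝ {r} {tower h n} (tw (suc h) x) r≤ (tw-∋ h {x} {n} n∈)

module _ {h q c : ℕ} (0<q : 0 < q) (bound : OrderBound q (3 * suc (suc (suc h))) h c) where

  ramsey-number-bound : ∀ m (H : Hypergraph (suc (suc (suc h)))) →
    size H ≡ m → NoIsolatedVertices H →
    ∀ σ → 0 < σ → m ≤ σ * σ → ∃ λ r → IsRamseyNumber H q r × r ≤ tower (suc (suc h)) (c * σ)
  ramsey-number-bound m H size≡m covered σ 0<σ m≤σ² =
    let r , isRamsey , r≤N = ramsey-number 0<q H {N} arrows in r , isRamsey , ≤-trans r≤N N≤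
    where
      K = 3 * suc (suc (suc h)) * σ
      Ram = ramsey q (suc (suc h)) K
      W = weight (capacities K)
      N = Ram * (suc q * Ram ^ K) ^ W
      arrows : Arrows H q N
      arrows χ = monochromatic-copy 0<q (suc (suc h)) K Ram ((suc q * Ram ^ K) ^ W) ≤-refl ≤-refl
        (m^n>0 (suc q) (ramsey q (suc h) K ^ suc (suc h))) χ
        (rainbow-placement H (s≤s z≤n) size≡m covered σ m≤σ²)
      N≤ : N ≤ tower (suc (suc h)) (c * σ)
      N≤ = bound σ W 0<σ (weight-capacities K)

  ramsey-number-≤ℝ : ∀ m .{{m≢0 : NonZero m}} (H : Hypergraph (suc (suc (suc h)))) →
    size H ≡ m → NoIsolatedVertices H →
    ∃ λ r → IsRamseyNumber H q r × r ≤ℝ tw (suc (suc (suc h))) (scale c · √ m {{m≢0}})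
  ramsey-number-≤ℝ m {{m≢0}} H size≡m covered = from-root (ceil-sqrt m)
    where
      from-root : (∃ λ σ → m ≤ σ * σ × σ * σ ≤ 4 * m) →
                  ∃ λ r → IsRamseyNumber H q r × r ≤ℝ tw (suc (suc (suc h))) (scale c · √ m {{m≢0}})
      from-root (σ , m≤σ² , σ²≤4m) = real-bound (ramsey-number-bound m H size≡m covered σ 0<σ m≤σ²)
        where
          0<σ : 0 < σ
          0<σ = n≢0⇒n>0 λ { refl → <⇒≱ (>-nonZero⁻¹ m) m≤σ² }
          real-bound : (∃ λ r → IsRamseyNumber H q r × r ≤ tower (suc (suc h)) (c * σ)) →
                       ∃ λ r → IsRamseyNumber H q r × r ≤ℝ tw (suc (suc (suc h))) (scale c · √ m {{m≢0}})
          real-bound (r , isRamsey , r≤) = r , isRamsey ,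
            ≤tower⇒≤ℝtw (suc (suc h)) _ {c * σ} {r} (scale·√-∋ c σ m {{m≢0}} 0<σ σ²≤4m) r≤

theorem1p2 : (k q : ℕ) → 3 ≤ k → 1 ≤ q →
    ∃ λ (C : ℝ⁺) → (m : ℕ) .{{_ : NonZero m}} (H : Hypergraph k) →
    size H ≡ m → NoIsolatedVertices H →
    ∃ λ (r : ℕ) → IsRamseyNumber H q r × r ≤ℝ tw k (C · √ m)
theorem1p2 (suc (suc (suc h))) q (s≤s (s≤s (s≤s _))) 0<q =
  let c , bound = order-bound {κ = 3 * suc (suc (suc h))} 0<q (s≤s z≤n) h
  in scale c , λ m {{m≢0}} → ramsey-number-≤ℝ 0<q bound m {{m≢0}}
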